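{- Let $f=a_0+a_1x+\cdots +a_nx^n\in \mathbb Z[x]$ be a polynomial with $a_0a_n\neq 0$, and put $H_f=\max_{0\leq i\leq n-1}|a_i|/|a_n|$. Suppose there exist natural numbers $m$, $d$, $k$, $j\leq n$, and a prime $p$ with $p\nmid d$, such that $m\geq H_f+d+1$ and $|f(m)|/d=p^k$ is coprime to $f^{(j)}(m)/j!$, where $f^{(j)}$ denotes the $j$-th derivative of $f$. Then the polynomial $f$ is a product of at most $\min\{k,j\}$ irreducible factors in $\mathbb Z[x]$. In particular, if $k=1$ or $j=1$ for such an $m$, then $f$ is irreducible in $\mathbb Z[x]$.
   Formalization: Irreducible factors are counted up to an integer constant: f = c·g₁⋯g_s with nonconstant irreducible g_i and s ≤ min{k,j}; irreducibility for k=1 or j=1 is likewise up to a constant. As stated the claim fails for f=2x+2, m=4, d=2, p=5, k=j=1. -}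

module Defs where

open import Data.Nat as ℕ using (ℕ; zero; suc; _!; _⊓_)
open import Data.Nat.Properties using (_!≢0)
open import Data.Nat.Coprimality using (Coprime)
open import Data.Nat.Divisibility using (_∣_)
open import Data.Nat.Primality using (Prime)
open import Data.Integer as Z using (ℤ; +_; -[1+_]; ∣_∣; _/ℕ_)
open import Data.List using (List; []; _∷_; [_]; length; foldr)
open import Data.List.Relation.Unary.All using (All)
open import Data.Product using (Σ; ∃; ∃-syntax; _×_)
open import Data.Sum using (_⊎_)
open import Relation.Binary.PropositionalEquality using (_≡_; _≢_)
open import Relation.Nullary using (¬_)

-- Polynomials in ℤ[x] as coefficient lists  a₀ ∷ a₁ ∷ … ∷ aₙ ∷ []
-- (constant term first).  Trailing zeros are allowed; equality of
-- polynomials is coefficientwise (_≈_).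

Poly : Set
Poly = List ℤ

coeff : Poly → ℕ → ℤ
coeff []       _       = + 0
coeff (a ∷ p)  zero    = a
coeff (a ∷ p)  (suc i) = coeff p i

infix 4 _≈_
_≈_ : Poly → Poly → Set
p ≈ q = ∀ i → coeff p i ≡ coeff q i

infixl 6 _⊕_
_⊕_ : Poly → Poly → Poly
[]      ⊕ q       = q
(a ∷ p) ⊕ []      = a ∷ p
(a ∷ p) ⊕ (b ∷ q) = (a Z.+ b) ∷ (p ⊕ q)

scale : ℤ → Poly → Poly
scale c []      = []
scale c (a ∷ p) = (c Z.* a) ∷ scale c p

infixl 7 _⊛_
_⊛_ : Poly → Poly → Poly
[]      ⊛ q = []
(a ∷ p) ⊛ q = scale a q ⊕ (+ 0 ∷ (p ⊛ q))

prod : List Poly → Poly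
prod = foldr _⊛_ [ + 1 ]

eval : Poly → ℤ → ℤ
eval []      x = + 0
eval (a ∷ p) x = a Z.+ x Z.* eval p x

private
  deriv-from : ℕ → Poly → Poly
  deriv-from k []      = []
  deriv-from k (a ∷ p) = (+ k Z.* a) ∷ deriv-from (suc k) p

deriv : Poly → Poly
deriv []      = []
deriv (a ∷ p) = deriv-from 1 p

deriv^ : ℕ → Poly → Poly
deriv^ zero    f = f
deriv^ (suc j) f = deriv (deriv^ j f)

-- f⁽ʲ⁾(m) / j!   (an exact integer division)
derivOverFact : ℕ → Poly → ℤ → ℤ
derivOverFact j f x = _/ℕ_ (eval (deriv^ j f) x) (j !) {{j !≢0}}

IsUnit : Poly → Set
IsUnit u = (u ≈ [ + 1 ]) ⊎ (u ≈ [ -[1+ 0 ] ])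

IsZero : Poly → Set
IsZero p = p ≈ []

Irreducible : Poly → Set
Irreducible p =
  ¬ IsZero p × ¬ IsUnit p ×
  (∀ g h → p ≈ g ⊛ h → IsUnit g ⊎ IsUnit h)

IsConstant : Poly → Set
IsConstant p = ∀ i → coeff p (suc i) ≡ + 0

-- f is a product of at most r irreducible factors, where (as the
-- theorem requires) the constant content of f is not
-- counted: f = c · g₁ ⋯ gₛ with gᵢ nonconstant irreducible, s ≤ r.
AtMostIrreducibleFactors : ℕ → Poly → Set
AtMostIrreducibleFactors r f =
  Σ ℤ λ c → Σ (List Poly) λ gs →
    All (λ g → Irreducible g × ¬ IsConstant g) gs ×
    length gs ℕ.≤ r ×
    f ≈ [ c ] ⊛ prod gs

-- The hypothesis  m ≥ H_f + d + 1,  H_f = max_{0≤i≤n-1} |aᵢ|/|aₙ|,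
-- written with denominators cleared (|aₙ| > 0):
--   m ≥ d + 1  and  ∀ i < n, |aᵢ| ≤ |aₙ| · (m − d − 1).
-- (For n = 0 the max is empty; we take H_f = 0.)
HeightBound : Poly → ℕ → ℕ → ℕ → Set
HeightBound f n m d =
  suc d ℕ.≤ m ×
  (∀ i → i ℕ.< n →
     ∣ coeff f i ∣ ℕ.≤ ∣ coeff f n ∣ ℕ.* (m ℕ.∸ suc d))

{-# OPTIONS --safe #-}
-- If g divides f and is nonconstant, then |g(m)| > d: otherwise the integral maps
-- v ↦ (g(m) v − v(m) g) / (x − m), transported to the multiples of a cofactor of g,
-- would strictly decrease the largest absolute value of the coefficients for ever.
-- Hence every nonconstant factor takes a value at m that does not divide d, so one
-- divisible by p.  For s such factors, pˢ divides f(m) = ± d pᵏ, giving s ≤ k, and f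
-- lies in the ideal (p, (x − m)ˢ), so p divides f⁽ⁱ⁾(m)/i! for all i < s, giving s ≤ j.
-- A factorisation into irreducibles is found by Kronecker's method: the coefficients
-- of a factor are bounded through its values at m, …, m + n, which leaves a finite
-- search, and splitting f terminates because the values at m get smaller.
module Submission where

open import Defs
open import Data.Nat
  using (ℕ; zero; suc; _+_; _*_; _∸_; _^_; _⊓_; _≤_; _<_; _≤?_; z≤n; s≤s; z<s; _!; NonZero; >-nonZero; ≢-nonZero)
import Data.Nat.Properties as ℕₚ
open import Data.Nat.Coprimality using (Coprime; coprime-divisor)
open import Data.Nat.Divisibility
  using (_∣_; divides; ∣⇒≤; ∣-refl; ∣-trans; m∣m*n; _∣0; _∣?_; 0∣⇒≡0; *-pres-∣; *-cancelʳ-∣)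
open import Data.Nat.Induction using (<-wellFounded)
open import Data.Nat.Primality using (Prime; prime⇒irreducible; ¬prime[1]; prime⇒nonZero)
open import Data.Integer as ℤ using (ℤ; +_; -[1+_]; ∣_∣)
import Data.Integer.DivMod as ℤ-DivMod
open import Data.Integer.Divisibility.Signed as ℤ∣ using () renaming (_∣_ to _∣ᶻ_)
import Data.Integer.Properties as ℤₚ
open import Data.Integer.Tactic.RingSolver using (solve-∀)
open import Data.List using (List; []; _∷_; [_]; length; map; _++_; upTo; applyUpTo; cartesianProductWith)
open import Data.List.Membership.Propositional using (_∈_; find; lose)
open import Data.List.Membership.Propositional.Properties
  using (∈-map⁺; ∈-upTo⁺; ∈-++⁺ˡ; ∈-++⁺ʳ; ∈-cartesianProductWith⁺)
open import Data.List.Properties using (length-applyUpTo)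
open import Data.List.Relation.Unary.All as All using (All; []; _∷_)
import Data.List.Relation.Unary.All.Properties as Allₚ
open import Data.List.Relation.Unary.Any using (here; any?)
open import Data.Product using (∃; _×_; _,_; proj₁; proj₂)
open import Data.Sum as Sum using (_⊎_; inj₁; inj₂; [_,_]′)
open import Data.Empty using (⊥; ⊥-elim)
open import Function using (_∘_)
open import Induction.WellFounded using (Acc; acc)
open import Relation.Binary.Definitions using (tri<; tri≈; tri>)
open import Relation.Binary.PropositionalEquality
  using (_≡_; _≢_; refl; sym; trans; cong; cong₂; subst; subst₂; module ≡-Reasoning)
open import Relation.Nullary using (¬_; Dec; yes; no)
open import Relation.Nullary.Decidable using (_×-dec_; _⊎-dec_; ¬?; map′)

-- Values and coefficients of polynomials, synthetic division, coefficient bounds from values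

eval-⊕ : ∀ p q x → eval (p ⊕ q) x ≡ eval p x ℤ.+ eval q x
eval-⊕ []      q       x = sym (ℤₚ.+-identityˡ _)
eval-⊕ (a ∷ p) []      x = sym (ℤₚ.+-identityʳ _)
eval-⊕ (a ∷ p) (b ∷ q) x rewrite eval-⊕ p q x = regroup a b x (eval p x) (eval q x)
  where
  regroup : ∀ a b x u v → (a ℤ.+ b) ℤ.+ x ℤ.* (u ℤ.+ v) ≡ (a ℤ.+ x ℤ.* u) ℤ.+ (b ℤ.+ x ℤ.* v)
  regroup = solve-∀

eval-scale : ∀ c p x → eval (scale c p) x ≡ c ℤ.* eval p x
eval-scale c []      x = sym (ℤₚ.*-zeroʳ c)
eval-scale c (a ∷ p) x rewrite eval-scale c p x = regroup c a x (eval p x)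
  where
  regroup : ∀ c a x u → c ℤ.* a ℤ.+ x ℤ.* (c ℤ.* u) ≡ c ℤ.* (a ℤ.+ x ℤ.* u)
  regroup = solve-∀

eval-⊛ : ∀ p q x → eval (p ⊛ q) x ≡ eval p x ℤ.* eval q x
eval-⊛ []      q x = refl
eval-⊛ (a ∷ p) q x
  rewrite eval-⊕ (scale a q) (+ 0 ∷ (p ⊛ q)) x | eval-scale a q x | eval-⊛ p q x
  = regroup a x (eval p x) (eval q x)
  where
  regroup : ∀ a x u v → a ℤ.* v ℤ.+ (+ 0 ℤ.+ x ℤ.* (u ℤ.* v)) ≡ (a ℤ.+ x ℤ.* u) ℤ.* v
  regroup = solve-∀

eval-constant : ∀ c x → eval [ c ] x ≡ c
eval-constant c x = trans (cong (ℤ._+_ c) (ℤₚ.*-zeroʳ x)) (ℤₚ.+-identityʳ c)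

eval-zero : ∀ p → p ≈ [] → ∀ x → eval p x ≡ + 0
eval-zero []      p≈0 x = refl
eval-zero (a ∷ p) p≈0 x rewrite p≈0 0 | eval-zero p (p≈0 ∘ suc) x = trans (ℤₚ.+-identityˡ _) (ℤₚ.*-zeroʳ x)

eval-cong : ∀ p q → p ≈ q → ∀ x → eval p x ≡ eval q x
eval-cong []      q       p≈q x = sym (eval-zero q (sym ∘ p≈q) x)
eval-cong (a ∷ p) []      p≈q x = eval-zero (a ∷ p) p≈q x
eval-cong (a ∷ p) (b ∷ q) p≈q x = cong₂ (λ c u → c ℤ.+ x ℤ.* u) (p≈q 0) (eval-cong p q (p≈q ∘ suc) x)

coeff-⊕ : ∀ p q i → coeff (p ⊕ q) i ≡ coeff p i ℤ.+ coeff q i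
coeff-⊕ []      q       i       = sym (ℤₚ.+-identityˡ _)
coeff-⊕ (a ∷ p) []      i       = sym (ℤₚ.+-identityʳ _)
coeff-⊕ (a ∷ p) (b ∷ q) zero    = refl
coeff-⊕ (a ∷ p) (b ∷ q) (suc i) = coeff-⊕ p q i

coeff-scale : ∀ c p i → coeff (scale c p) i ≡ c ℤ.* coeff p i
coeff-scale c []      i       = sym (ℤₚ.*-zeroʳ c)
coeff-scale c (a ∷ p) zero    = refl
coeff-scale c (a ∷ p) (suc i) = coeff-scale c p i

coeff-length : ∀ p i → length p ≤ i → coeff p i ≡ + 0
coeff-length []      i       _         = refl
coeff-length (a ∷ p) (suc i) (s≤s l≤i) = coeff-length p i l≤i

-- Synthetic division: the entries are Horner's partial values at `c`, which are the coefficients of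
-- the quotient of `x p(x) − c p(c)` by `x − c`.
horner : ℤ → Poly → Poly
horner c []      = []
horner c (a ∷ p) = eval (a ∷ p) c ∷ horner c p

length-horner : ∀ c p → length (horner c p) ≡ length p
length-horner c []      = refl
length-horner c (a ∷ p) = cong suc (length-horner c p)

eval-horner : ∀ c p x → (x ℤ.- c) ℤ.* eval (horner c p) x ≡ x ℤ.* eval p x ℤ.- c ℤ.* eval p c
eval-horner c []      x = vanish x c
  where
  vanish : ∀ x c → (x ℤ.- c) ℤ.* + 0 ≡ x ℤ.* + 0 ℤ.- c ℤ.* + 0
  vanish = solve-∀
eval-horner c (a ∷ p) x = begin
  (x ℤ.- c) ℤ.* ((a ℤ.+ c ℤ.* eval p c) ℤ.+ x ℤ.* eval (horner c p) x)
    ≡⟨ expand x c (a ℤ.+ c ℤ.* eval p c) (eval (horner c p) x) ⟩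
  (x ℤ.- c) ℤ.* (a ℤ.+ c ℤ.* eval p c) ℤ.+ x ℤ.* ((x ℤ.- c) ℤ.* eval (horner c p) x)
    ≡⟨ cong (λ u → (x ℤ.- c) ℤ.* (a ℤ.+ c ℤ.* eval p c) ℤ.+ x ℤ.* u) (eval-horner c p x) ⟩
  (x ℤ.- c) ℤ.* (a ℤ.+ c ℤ.* eval p c) ℤ.+ x ℤ.* (x ℤ.* eval p x ℤ.- c ℤ.* eval p c)
    ≡⟨ collect a x c (eval p c) (eval p x) ⟩
  x ℤ.* (a ℤ.+ x ℤ.* eval p x) ℤ.- c ℤ.* (a ℤ.+ c ℤ.* eval p c) ∎
  where
  open ≡-Reasoning
  expand : ∀ x c u v → (x ℤ.- c) ℤ.* (u ℤ.+ x ℤ.* v) ≡ (x ℤ.- c) ℤ.* u ℤ.+ x ℤ.* ((x ℤ.- c) ℤ.* v)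
  expand = solve-∀
  collect : ∀ a x c u v → (x ℤ.- c) ℤ.* (a ℤ.+ c ℤ.* u) ℤ.+ x ℤ.* (x ℤ.* v ℤ.- c ℤ.* u)
    ≡ x ℤ.* (a ℤ.+ x ℤ.* v) ℤ.- c ℤ.* (a ℤ.+ c ℤ.* u)
  collect = solve-∀

coeff-horner-zero : ∀ c p → coeff (horner c p) 0 ≡ eval p c
coeff-horner-zero c []      = refl
coeff-horner-zero c (a ∷ p) = refl

-- One Horner step solved for the coefficient of `p`. It carries bounds on the coefficients of a
-- quotient back to the polynomial that was divided.
coeff-horner : ∀ c p i → coeff p i ≡ coeff (horner c p) i ℤ.- c ℤ.* coeff (horner c p) (suc i)
coeff-horner c []      i       = vanish c
  where
  vanish : ∀ c → + 0 ≡ + 0 ℤ.- c ℤ.* + 0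
  vanish = solve-∀
coeff-horner c (a ∷ p) zero    rewrite coeff-horner-zero c p = cancel a c (eval p c)
  where
  cancel : ∀ a c u → a ≡ a ℤ.+ c ℤ.* u ℤ.- c ℤ.* u
  cancel = solve-∀
coeff-horner c (a ∷ p) (suc i) = coeff-horner c p i

-- The constant term cancels in `p(x) − p(c)`, so dividing this difference by `x − c` is a Horner
-- division of the tail.
quotient : ℤ → Poly → Poly
quotient c []      = []
quotient c (a ∷ p) = horner c p

eval-quotient : ∀ c p x → (x ℤ.- c) ℤ.* eval (quotient c p) x ≡ eval p x ℤ.- eval p c
eval-quotient c []      x = ℤₚ.*-zeroʳ (x ℤ.- c)
eval-quotient c (a ∷ p) x = trans (eval-horner c p x) (shift a x c (eval p x) (eval p c))
  where
  shift : ∀ a x c u v → x ℤ.* u ℤ.- c ℤ.* v ≡ (a ℤ.+ x ℤ.* u) ℤ.- (a ℤ.+ c ℤ.* v)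
  shift = solve-∀

-- The recursion follows one division by `x − N`: the quotient has one coefficient less and values
-- at most `B + B` from `suc N` on. Multiplying back by `x − N` costs the factor `suc N`, and the
-- summand `B` accounts for the value at `N` in the constant term.
coeffBound : ℕ → ℕ → ℕ → ℕ
coeffBound zero    N B = 0
coeffBound (suc l) N B = B + suc N * coeffBound l (suc N) (B + B)

-- Dividing the difference p(x) − p(N) by x − N turns a bound on the values of p
-- at N, N+1, … into one on the values of the quotient at N+1, N+2, …
∣coeff∣≤coeffBound : ∀ l p N B → length p ≡ l →
  (∀ i → i < l → ∣ eval p (+ (N + i)) ∣ ≤ B) → ∀ k → ∣ coeff p k ∣ ≤ coeffBound l N B
∣coeff∣≤coeffBound zero    []      N B _   _      k = z≤n
∣coeff∣≤coeffBound (suc l) (a ∷ p) N B len values k = bound k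
  where
  open ℕₚ.≤-Reasoning
  q = horner (+ N) p
  K = coeffBound l (suc N) (B + B)
  value-N : ∣ eval (a ∷ p) (+ N) ∣ ≤ B
  value-N = subst (λ x → ∣ eval (a ∷ p) (+ x) ∣ ≤ B) (ℕₚ.+-identityʳ N) (values 0 z<s)
  gap : ∀ i → + (suc N + i) ℤ.- + N ≡ + suc i
  gap i = trans (cong (λ x → + x ℤ.- + N) (sym (ℕₚ.+-suc N i))) (cancel (+ N) (+ suc i))
    where
    cancel : ∀ x y → (x ℤ.+ y) ℤ.- x ≡ y
    cancel = solve-∀
  q-values : ∀ i → i < l → ∣ eval q (+ (suc N + i)) ∣ ≤ B + B
  q-values i i<l = begin
    -- The divisor `x − N` equals `suc i` here, hence is at least 1, so dividing by it cannot
    -- enlarge the value.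
    ∣ eval q x ∣                                 ≤⟨ ℕₚ.m≤n*m _ (suc i) ⟩
    suc i * ∣ eval q x ∣                         ≡⟨ ℤₚ.abs-* (+ suc i) (eval q x) ⟨
    ∣ + suc i ℤ.* eval q x ∣                     ≡⟨ cong (λ y → ∣ y ℤ.* eval q x ∣) (gap i) ⟨
    ∣ (x ℤ.- + N) ℤ.* eval q x ∣                 ≡⟨ cong ∣_∣ (eval-quotient (+ N) (a ∷ p) x) ⟩
    ∣ eval (a ∷ p) x ℤ.- eval (a ∷ p) (+ N) ∣     ≤⟨ ℤₚ.∣i-j∣≤∣i∣+∣j∣ (eval (a ∷ p) x) _ ⟩
    ∣ eval (a ∷ p) x ∣ + ∣ eval (a ∷ p) (+ N) ∣   ≤⟨ ℕₚ.+-mono-≤ value-x value-N ⟩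
    B + B                                        ∎
    where
    x = + (suc N + i)
    value-x : ∣ eval (a ∷ p) x ∣ ≤ B
    value-x = subst (λ y → ∣ eval (a ∷ p) (+ y) ∣ ≤ B) (ℕₚ.+-suc N i) (values (suc i) (s≤s i<l))
  q-bound : ∀ i → ∣ coeff q i ∣ ≤ K
  q-bound = ∣coeff∣≤coeffBound l q (suc N) (B + B)
    (trans (length-horner (+ N) p) (ℕₚ.suc-injective len)) q-values
  scaled-bound : ∀ i → ∣ + N ℤ.* coeff q i ∣ ≤ N * K
  scaled-bound i = ℕₚ.≤-trans (ℕₚ.≤-reflexive (ℤₚ.abs-* (+ N) (coeff q i))) (ℕₚ.*-monoʳ-≤ N (q-bound i))
  bound : ∀ k → ∣ coeff (a ∷ p) k ∣ ≤ B + suc N * K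
  bound zero = begin
    ∣ a ∣                                                  ≡⟨ cong ∣_∣ (cancel a (+ N ℤ.* eval p (+ N))) ⟩
    ∣ eval (a ∷ p) (+ N) ℤ.- + N ℤ.* eval p (+ N) ∣         ≡⟨ cong (λ y → ∣ eval (a ∷ p) (+ N) ℤ.- + N ℤ.* y ∣) (coeff-horner-zero (+ N) p) ⟨
    ∣ eval (a ∷ p) (+ N) ℤ.- + N ℤ.* coeff q 0 ∣            ≤⟨ ℤₚ.∣i-j∣≤∣i∣+∣j∣ (eval (a ∷ p) (+ N)) _ ⟩
    ∣ eval (a ∷ p) (+ N) ∣ + ∣ + N ℤ.* coeff q 0 ∣          ≤⟨ ℕₚ.+-mono-≤ value-N (scaled-bound 0) ⟩
    B + N * K                                              ≤⟨ ℕₚ.+-monoʳ-≤ B (ℕₚ.m≤n+m (N * K) K) ⟩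
    B + suc N * K                                          ∎
    where
    cancel : ∀ a u → a ≡ a ℤ.+ u ℤ.- u
    cancel = solve-∀
  bound (suc i) = begin
    ∣ coeff p i ∣                                ≡⟨ cong ∣_∣ (coeff-horner (+ N) p i) ⟩
    ∣ coeff q i ℤ.- + N ℤ.* coeff q (suc i) ∣    ≤⟨ ℤₚ.∣i-j∣≤∣i∣+∣j∣ (coeff q i) _ ⟩
    ∣ coeff q i ∣ + ∣ + N ℤ.* coeff q (suc i) ∣  ≤⟨ ℕₚ.+-mono-≤ (q-bound i) (scaled-bound (suc i)) ⟩
    suc N * K                                    ≤⟨ ℕₚ.m≤n+m (suc N * K) B ⟩
    B + suc N * K                                ∎

coeffBound-zero : ∀ l N → coeffBound l N 0 ≡ 0
coeffBound-zero zero    N = refl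
coeffBound-zero (suc l) N = trans (cong (suc N *_) (coeffBound-zero l (suc N))) (ℕₚ.*-zeroʳ (suc N))

-- The difference has only zero values, so the coefficient bound applies with `B = 0` and is itself
-- zero. Polynomial identities below are therefore proved as integer identities between values.
eval-injective : ∀ p q → (∀ x → eval p x ≡ eval q x) → p ≈ q
eval-injective p q same i = ℤₚ.i-j≡0⇒i≡j (coeff p i) (coeff q i) (begin
  coeff p i ℤ.- coeff q i                  ≡⟨ minus (coeff p i) (coeff q i) ⟨
  coeff p i ℤ.+ ℤ.-1ℤ ℤ.* coeff q i        ≡⟨ cong (ℤ._+_ (coeff p i)) (coeff-scale ℤ.-1ℤ q i) ⟨
  coeff p i ℤ.+ coeff (scale ℤ.-1ℤ q) i    ≡⟨ coeff-⊕ p (scale ℤ.-1ℤ q) i ⟨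
  coeff r i                                ≡⟨ ℤₚ.∣i∣≡0⇒i≡0 (ℕₚ.n≤0⇒n≡0 r-bound) ⟩
  + 0                                      ∎)
  where
  open ≡-Reasoning
  r = p ⊕ scale ℤ.-1ℤ q
  minus : ∀ u v → u ℤ.+ ℤ.-1ℤ ℤ.* v ≡ u ℤ.- v
  minus u v = cong (ℤ._+_ u) (ℤₚ.-1*i≡-i v)
  eval-r : ∀ x → eval r x ≡ + 0
  eval-r x = begin
    eval r x                             ≡⟨ eval-⊕ p (scale ℤ.-1ℤ q) x ⟩
    eval p x ℤ.+ eval (scale ℤ.-1ℤ q) x  ≡⟨ cong₂ ℤ._+_ (same x) (eval-scale ℤ.-1ℤ q x) ⟩
    eval q x ℤ.+ ℤ.-1ℤ ℤ.* eval q x      ≡⟨ minus (eval q x) (eval q x) ⟩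
    eval q x ℤ.- eval q x                ≡⟨ ℤₚ.i≡j⇒i-j≡0 {eval q x} refl ⟩
    + 0                                  ∎
  r-bound : ∣ coeff r i ∣ ≤ 0
  r-bound = subst (∣ coeff r i ∣ ≤_) (coeffBound-zero (length r) 0)
    (∣coeff∣≤coeffBound (length r) r 0 0 refl (λ k _ → ℕₚ.≤-reflexive (cong ∣_∣ (eval-r (+ k)))) i)

-- Degrees and the values of factors

-- A relation rather than a function of the list: trailing zeros make the length unreliable, and the
-- zero polynomial has no degree.
HasDegree : Poly → ℕ → Set
HasDegree p r = coeff p r ≢ + 0 × (∀ i → r < i → coeff p i ≡ + 0)

zero-or-degree : ∀ p → p ≈ [] ⊎ ∃ (HasDegree p)
zero-or-degree []      = inj₁ λ _ → refl
zero-or-degree (a ∷ p) with zero-or-degree p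
... | inj₂ (r , pᵣ≢0 , high) = inj₂ (suc r , pᵣ≢0 , λ where (suc i) (s≤s r<i) → high i r<i)
... | inj₁ p≈0 with a ℤ.≟ + 0
...   | yes a≡0 = inj₁ λ where
  zero    → a≡0
  (suc i) → p≈0 i
...   | no  a≢0 = inj₂ (0 , a≢0 , λ where (suc i) _ → p≈0 i)

degree-unique : ∀ p {r s} → HasDegree p r → HasDegree p s → r ≡ s
degree-unique p {r} {s} (pᵣ≢0 , highʳ) (pₛ≢0 , highˢ) with ℕₚ.<-cmp r s
... | tri< r<s _ _ = ⊥-elim (pₛ≢0 (highʳ s r<s))
... | tri≈ _ r≡s _ = r≡s
... | tri> _ _ s<r = ⊥-elim (pᵣ≢0 (highˢ r s<r))

⊛-zeroˡ : ∀ p q → p ≈ [] → p ⊛ q ≈ []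
⊛-zeroˡ p q p≈0 = eval-injective (p ⊛ q) [] λ x →
  trans (eval-⊛ p q x) (cong (ℤ._* eval q x) (eval-zero p p≈0 x))

⊛-zeroʳ : ∀ p q → q ≈ [] → p ⊛ q ≈ []
⊛-zeroʳ p q q≈0 = eval-injective (p ⊛ q) [] λ x →
  trans (eval-⊛ p q x) (trans (cong (eval p x ℤ.*_) (eval-zero q q≈0 x)) (ℤₚ.*-zeroʳ (eval p x)))

coeff-cons-⊛ : ∀ a p q i → coeff ((a ∷ p) ⊛ q) i ≡ a ℤ.* coeff q i ℤ.+ coeff (+ 0 ∷ (p ⊛ q)) i
coeff-cons-⊛ a p q i = trans (coeff-⊕ (scale a q) _ i) (cong (ℤ._+ _) (coeff-scale a q i))

-- Above index `s` the summand `scale a q` is zero, so the top of the product is that of the tail,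
-- shifted by one. Here `r` and `s` are only upper bounds for the degrees; nonvanishing enters in
-- `degree-⊛`, since the integers have no zero divisors.
coeff-⊛-top : ∀ p q r s → (∀ i → r < i → coeff p i ≡ + 0) → (∀ i → s < i → coeff q i ≡ + 0) →
  coeff (p ⊛ q) (r + s) ≡ coeff p r ℤ.* coeff q s × (∀ i → r + s < i → coeff (p ⊛ q) i ≡ + 0)
coeff-⊛-top []      q r       s _    _    = refl , λ _ _ → refl
coeff-⊛-top (a ∷ p) q zero    s p-hi q-hi =
  constant-term s , λ i s<i → trans (constant-term i) (trans (cong (a ℤ.*_) (q-hi i s<i)) (ℤₚ.*-zeroʳ a))
  where
  tail-zero : p ⊛ q ≈ []
  tail-zero = ⊛-zeroˡ p q (λ i → p-hi (suc i) z<s)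
  shifted-zero : ∀ i → coeff (+ 0 ∷ (p ⊛ q)) i ≡ + 0
  shifted-zero zero    = refl
  shifted-zero (suc i) = tail-zero i
  constant-term : ∀ i → coeff ((a ∷ p) ⊛ q) i ≡ a ℤ.* coeff q i
  constant-term i = trans (coeff-cons-⊛ a p q i)
    (trans (cong (ℤ._+_ (a ℤ.* coeff q i)) (shifted-zero i)) (ℤₚ.+-identityʳ _))
coeff-⊛-top (a ∷ p) q (suc r) s p-hi q-hi with coeff-⊛-top p q r s (λ i r<i → p-hi (suc i) (s≤s r<i)) q-hi
... | top , high =
    trans (drop-head (r + s) (s≤s (ℕₚ.m≤n+m s r))) top
  , λ where (suc i) (s≤s r+s<i) → trans (drop-head i (ℕₚ.≤-trans (s≤s (ℕₚ.m≤n+m s r)) (ℕₚ.≤-trans r+s<i (ℕₚ.n≤1+n i)))) (high i r+s<i)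
  where
  drop-head : ∀ i → s < suc i → coeff ((a ∷ p) ⊛ q) (suc i) ≡ coeff (p ⊛ q) i
  drop-head i s<1+i = trans (coeff-cons-⊛ a p q (suc i))
    (trans (cong (λ c → a ℤ.* c ℤ.+ coeff (p ⊛ q) i) (q-hi (suc i) s<1+i))
      (trans (cong (ℤ._+ coeff (p ⊛ q) i) (ℤₚ.*-zeroʳ a)) (ℤₚ.+-identityˡ _)))

degree-⊛ : ∀ p q {r s} → HasDegree p r → HasDegree q s → HasDegree (p ⊛ q) (r + s)
degree-⊛ p q {r} {s} (pᵣ≢0 , p-hi) (qₛ≢0 , q-hi) with coeff-⊛-top p q r s p-hi q-hi
... | top , high = nonzero , high
  where
  nonzero : coeff (p ⊛ q) (r + s) ≢ + 0
  nonzero eq with ℤₚ.i*j≡0⇒i≡0∨j≡0 (coeff p r) (trans (sym top) eq)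
  ... | inj₁ pᵣ≡0 = pᵣ≢0 pᵣ≡0
  ... | inj₂ qₛ≡0 = qₛ≢0 qₛ≡0

degree-cong : ∀ p q {r} → p ≈ q → HasDegree p r → HasDegree q r
degree-cong p q p≈q (pᵣ≢0 , high) =
  (λ qᵣ≡0 → pᵣ≢0 (trans (p≈q _) qᵣ≡0)) , λ i r<i → trans (sym (p≈q i)) (high i r<i)

factor-degrees : ∀ f g h {n} → f ≈ g ⊛ h → HasDegree f n →
  ∃ λ r → ∃ λ s → HasDegree g r × HasDegree h s × r + s ≡ n
factor-degrees f g h {n} f≈gh deg-f with zero-or-degree g | zero-or-degree h
... | inj₁ g≈0 | _ = ⊥-elim (proj₁ deg-f (trans (f≈gh n) (⊛-zeroˡ g h g≈0 n)))
... | inj₂ _ | inj₁ h≈0 = ⊥-elim (proj₁ deg-f (trans (f≈gh n) (⊛-zeroʳ g h h≈0 n)))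
... | inj₂ (r , deg-g) | inj₂ (s , deg-h) =
  r , s , deg-g , deg-h , degree-unique (g ⊛ h) (degree-⊛ g h deg-g deg-h) (degree-cong f (g ⊛ h) f≈gh deg-f)

-- The index is the first one at which the absolute value is maximal.
zero-or-peak : ∀ p → p ≈ [] ⊎ ∃ λ i → coeff p i ≢ + 0 ×
  (∀ k → ∣ coeff p k ∣ ≤ ∣ coeff p i ∣) × (∀ k → k < i → ∣ coeff p k ∣ < ∣ coeff p i ∣)
zero-or-peak []      = inj₁ λ _ → refl
zero-or-peak (a ∷ p) with zero-or-peak p
... | inj₁ p≈0 with a ℤ.≟ + 0
...   | yes a≡0 = inj₁ λ where
  zero    → a≡0
  (suc k) → p≈0 k
...   | no  a≢0 = inj₂ (0 , a≢0 , (λ where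
    zero    → ℕₚ.≤-refl
    (suc k) → ℕₚ.≤-trans (ℕₚ.≤-reflexive (cong ∣_∣ (p≈0 k))) z≤n) , λ _ ())
zero-or-peak (a ∷ p) | inj₂ (i , pᵢ≢0 , max , first) with ∣ coeff p i ∣ ≤? ∣ a ∣
... | yes pᵢ≤a = inj₂ (0 , (λ a≡0 → pᵢ≢0 (ℤₚ.∣i∣≡0⇒i≡0 (ℕₚ.n≤0⇒n≡0 (subst (λ z → ∣ coeff p i ∣ ≤ ∣ z ∣) a≡0 pᵢ≤a)))) ,
  (λ where
    zero    → ℕₚ.≤-refl
    (suc k) → ℕₚ.≤-trans (max k) pᵢ≤a) , λ _ ())
... | no  pᵢ≰a = inj₂ (suc i , pᵢ≢0 ,
  (λ where
    zero    → ℕₚ.<⇒≤ (ℕₚ.≰⇒> pᵢ≰a)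
    (suc k) → max k) ,
  λ where
    zero    _         → ℕₚ.≰⇒> pᵢ≰a
    (suc k) (s≤s k<i) → first k k<i)

∣i∣>0 : ∀ {i} → i ≢ + 0 → 0 < ∣ i ∣
∣i∣>0 i≢0 = ℕₚ.n≢0⇒n>0 (i≢0 ∘ ℤₚ.∣i∣≡0⇒i≡0)

module _ (f g h : Poly) (n m d : ℕ) (f≈gh : f ≈ g ⊛ h) (deg-f : HasDegree f n) (height : HeightBound f n m d) where

  private
    e : ℤ
    e = eval g (+ m)

  -- With w = h v and e = g(m), the polynomial v' = (e v − v(m) g) / (x − m) is integral
  -- and w' = h v' satisfies (x − m) w' = e w − v(m) f.  Comparing coefficients at the
  -- first largest coefficient of w' gives m |w'ᵢ| < |w'ᵢ| + |e wᵢ| + (m − d − 1) |w'ᵢ|.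
  descent-step : ∀ v M →
    (∀ i → n ≤ i → coeff (h ⊛ v) i ≡ + 0) →
    (∀ i → ∣ e ℤ.* coeff (h ⊛ v) i ∣ ≤ d * M) →
    ¬ (eval v (+ m) ≡ + 0 × (∀ i → e ℤ.* coeff (h ⊛ v) i ≡ + 0)) →
    ∃ λ v' → (∀ i → n ≤ i → coeff (h ⊛ v') i ≡ + 0) × ¬ (h ⊛ v' ≈ []) ×
    ∃ λ M' → M' < M × (∀ i → ∣ coeff (h ⊛ v') i ∣ ≤ M')
  descent-step v M w-high w-bound nontrivial = v' , w'-high , w'≉0 , from-peak (zero-or-peak w')
    where
    b : ℤ
    b = eval v (+ m)
    u v' w w' : Poly
    -- The multiple of `g` is chosen so that `u` vanishes at `m`; division by `x − m` then leaves no
    -- remainder.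
    u  = scale e v ⊕ scale (ℤ.- b) g
    v' = quotient (+ m) u
    w  = h ⊛ v
    w' = h ⊛ v'

    eval-u : ∀ x → eval u x ≡ e ℤ.* eval v x ℤ.- b ℤ.* eval g x
    eval-u x rewrite eval-⊕ (scale e v) (scale (ℤ.- b) g) x | eval-scale e v x | eval-scale (ℤ.- b) g x =
      cong (ℤ._+_ (e ℤ.* eval v x)) (sym (ℤₚ.neg-distribˡ-* b (eval g x)))

    u-root : eval u (+ m) ≡ + 0
    u-root = trans (eval-u (+ m)) (cancel e b)
      where
      cancel : ∀ e b → e ℤ.* b ℤ.- b ℤ.* e ≡ + 0
      cancel = solve-∀

    eval-v' : ∀ x → (x ℤ.- + m) ℤ.* eval v' x ≡ e ℤ.* eval v x ℤ.- b ℤ.* eval g x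
    eval-v' x = trans (eval-quotient (+ m) u x)
      (trans (cong (λ y → eval u x ℤ.- y) u-root) (trans (ℤₚ.+-identityʳ _) (eval-u x)))

    -- `lhs` is `x w'`: the identity `(x − m) w' = e w − b f` is used with `m w'` moved to the
    -- right, so that index `i` on the left reads coefficient `i − 1` of `w'`.
    lhs rhs : Poly
    lhs = + 0 ∷ w'
    rhs = scale (+ m) w' ⊕ (scale e w ⊕ scale (ℤ.- b) f)

    lhs≈rhs : lhs ≈ rhs
    lhs≈rhs = eval-injective lhs rhs λ x → begin
      + 0 ℤ.+ x ℤ.* eval w' x
        ≡⟨ split x (+ m) (eval w' x) ⟩
      + m ℤ.* eval w' x ℤ.+ (x ℤ.- + m) ℤ.* eval w' x
        ≡⟨ cong (λ y → + m ℤ.* eval w' x ℤ.+ (x ℤ.- + m) ℤ.* y) (eval-⊛ h v' x) ⟩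
      + m ℤ.* eval w' x ℤ.+ (x ℤ.- + m) ℤ.* (eval h x ℤ.* eval v' x)
        ≡⟨ cong (ℤ._+_ (+ m ℤ.* eval w' x)) (swap (x ℤ.- + m) (eval h x) (eval v' x)) ⟩
      + m ℤ.* eval w' x ℤ.+ eval h x ℤ.* ((x ℤ.- + m) ℤ.* eval v' x)
        ≡⟨ cong (λ y → + m ℤ.* eval w' x ℤ.+ eval h x ℤ.* y) (eval-v' x) ⟩
      + m ℤ.* eval w' x ℤ.+ eval h x ℤ.* (e ℤ.* eval v x ℤ.- b ℤ.* eval g x)
        ≡⟨ cong (ℤ._+_ (+ m ℤ.* eval w' x)) (distribute (eval h x) e (eval v x) b (eval g x)) ⟩
      + m ℤ.* eval w' x ℤ.+ (e ℤ.* (eval h x ℤ.* eval v x) ℤ.+ ℤ.- b ℤ.* (eval g x ℤ.* eval h x))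
        ≡⟨ cong₂ (λ y z → + m ℤ.* eval w' x ℤ.+ (e ℤ.* y ℤ.+ ℤ.- b ℤ.* z)) (sym (eval-⊛ h v x))
             (sym (trans (eval-cong f (g ⊛ h) f≈gh x) (eval-⊛ g h x))) ⟩
      + m ℤ.* eval w' x ℤ.+ (e ℤ.* eval w x ℤ.+ ℤ.- b ℤ.* eval f x)
        ≡⟨ eval-rhs x ⟨
      eval rhs x ∎
      where
      open ≡-Reasoning
      split : ∀ x c y → + 0 ℤ.+ x ℤ.* y ≡ c ℤ.* y ℤ.+ (x ℤ.- c) ℤ.* y
      split = solve-∀
      swap : ∀ x y z → x ℤ.* (y ℤ.* z) ≡ y ℤ.* (x ℤ.* z)
      swap = solve-∀
      distribute : ∀ H E V B G → H ℤ.* (E ℤ.* V ℤ.- B ℤ.* G) ≡ E ℤ.* (H ℤ.* V) ℤ.+ ℤ.- B ℤ.* (G ℤ.* H)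
      distribute = solve-∀
      eval-rhs : ∀ x → eval rhs x ≡ + m ℤ.* eval w' x ℤ.+ (e ℤ.* eval w x ℤ.+ ℤ.- b ℤ.* eval f x)
      eval-rhs x rewrite eval-⊕ (scale (+ m) w') (scale e w ⊕ scale (ℤ.- b) f) x
        | eval-⊕ (scale e w) (scale (ℤ.- b) f) x
        | eval-scale (+ m) w' x | eval-scale e w x | eval-scale (ℤ.- b) f x = refl

    recurrence : ∀ i → coeff lhs i ≡ + m ℤ.* coeff w' i ℤ.+ (e ℤ.* coeff w i ℤ.+ ℤ.- b ℤ.* coeff f i)
    recurrence i = trans (lhs≈rhs i) coeff-rhs
      where
      coeff-rhs : coeff rhs i ≡ + m ℤ.* coeff w' i ℤ.+ (e ℤ.* coeff w i ℤ.+ ℤ.- b ℤ.* coeff f i)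
      coeff-rhs rewrite coeff-⊕ (scale (+ m) w') (scale e w ⊕ scale (ℤ.- b) f) i
        | coeff-⊕ (scale e w) (scale (ℤ.- b) f) i
        | coeff-scale (+ m) w' i | coeff-scale e w i | coeff-scale (ℤ.- b) f i = refl

    w'-high : ∀ i → n ≤ i → coeff w' i ≡ + 0
    w'-high with zero-or-degree w'
    ... | inj₁ w'≈0 = λ i _ → w'≈0 i
    ... | inj₂ (t , w'ₜ≢0 , high) = λ i n≤i → high i (ℕₚ.<-≤-trans t<n n≤i)
      where
      -- If `n ≤ t`, every term on the right of the recurrence at `suc t` vanishes, while the left
      -- side is the nonzero leading coefficient of `w'`.
      t<n : t < n
      t<n = ℕₚ.≰⇒> λ n≤t → w'ₜ≢0 (trans (recurrence (suc t)) (vanish n≤t))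
        where
        vanish : n ≤ t → + m ℤ.* coeff w' (suc t) ℤ.+ (e ℤ.* coeff w (suc t) ℤ.+ ℤ.- b ℤ.* coeff f (suc t)) ≡ + 0
        vanish n≤t rewrite high (suc t) ℕₚ.≤-refl | w-high (suc t) (ℕₚ.m≤n⇒m≤1+n n≤t)
          | proj₂ deg-f (suc t) (s≤s n≤t) = zeros (+ m) e (ℤ.- b)
          where
          zeros : ∀ x y z → x ℤ.* + 0 ℤ.+ (y ℤ.* + 0 ℤ.+ z ℤ.* + 0) ≡ + 0
          zeros = solve-∀

    -- At index `n` only the term of `f` survives. This makes `b fₙ` a coefficient of `w'` up to
    -- sign, which is how `b` gets controlled.
    leading : coeff lhs n ≡ ℤ.- b ℤ.* coeff f n
    leading = trans (recurrence n) vanish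
      where
      vanish : + m ℤ.* coeff w' n ℤ.+ (e ℤ.* coeff w n ℤ.+ ℤ.- b ℤ.* coeff f n) ≡ ℤ.- b ℤ.* coeff f n
      vanish rewrite w'-high n ℕₚ.≤-refl | w-high n ℕₚ.≤-refl = zeros (+ m) e (ℤ.- b ℤ.* coeff f n)
        where
        zeros : ∀ x y z → x ℤ.* + 0 ℤ.+ (y ℤ.* + 0 ℤ.+ z) ≡ z
        zeros = solve-∀

    -- If `w'` vanished, index `n` would force `b = 0` because `fₙ` is nonzero, and the recurrence
    -- would then leave `e w = 0`.
    w'≉0 : ¬ (w' ≈ [])
    w'≉0 w'≈0 = nontrivial (b≡0 , ew≡0)
      where
      lhs-zero : ∀ i → coeff lhs i ≡ + 0
      lhs-zero zero    = refl
      lhs-zero (suc i) = w'≈0 i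
      b≡0 : b ≡ + 0
      b≡0 = [ ℤₚ.neg-injective , (λ fₙ≡0 → ⊥-elim (proj₁ deg-f fₙ≡0)) ]′
        (ℤₚ.i*j≡0⇒i≡0∨j≡0 (ℤ.- b) (trans (sym leading) (lhs-zero n)))
      ew≡0 : ∀ i → e ℤ.* coeff w i ≡ + 0
      ew≡0 i = trans (sym (trans (recurrence i) simplify)) (lhs-zero i)
        where
        simplify : + m ℤ.* coeff w' i ℤ.+ (e ℤ.* coeff w i ℤ.+ ℤ.- b ℤ.* coeff f i) ≡ e ℤ.* coeff w i
        simplify = trans
          (cong₂ (λ y z → + m ℤ.* y ℤ.+ (e ℤ.* coeff w i ℤ.+ ℤ.- z ℤ.* coeff f i)) (w'≈0 i) b≡0)
          (zeros (+ m) (e ℤ.* coeff w i) (coeff f i))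
          where
          zeros : ∀ x y z → x ℤ.* + 0 ℤ.+ (y ℤ.+ + 0 ℤ.* z) ≡ y
          zeros = solve-∀

    from-peak : (w' ≈ [] ⊎ ∃ λ i → coeff w' i ≢ + 0 ×
      (∀ k → ∣ coeff w' k ∣ ≤ ∣ coeff w' i ∣) × (∀ k → k < i → ∣ coeff w' k ∣ < ∣ coeff w' i ∣)) →
      ∃ λ M' → M' < M × (∀ i → ∣ coeff w' i ∣ ≤ M')
    from-peak (inj₁ w'≈0) = ⊥-elim (w'≉0 w'≈0)
    from-peak (inj₂ (i , w'ᵢ≢0 , max , first)) = M' , ℕₚ.*-cancelˡ-< d M' M dM'<dM , max
      where
      open ℕₚ.≤-Reasoning
      M' c : ℕ
      M' = ∣ coeff w' i ∣
      c  = m ∸ suc d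
      i<n : i < n
      i<n = ℕₚ.≰⇒> (w'ᵢ≢0 ∘ w'-high i)
      -- The strict inequality of the whole estimate arises here: this coefficient precedes the
      -- first maximal one, or is the zero at index 0.
      lhs-i : ∣ coeff lhs i ∣ < M'
      lhs-i = below-peak i first
        where
        below-peak : ∀ k → (∀ l → l < k → ∣ coeff w' l ∣ < M') → ∣ coeff lhs k ∣ < M'
        below-peak zero    _     = ∣i∣>0 w'ᵢ≢0
        below-peak (suc k) below = below k ℕₚ.≤-refl
      lhs-n : ∣ coeff lhs n ∣ ≤ M'
      lhs-n = upto-peak n
        where
        upto-peak : ∀ k → ∣ coeff lhs k ∣ ≤ M'
        upto-peak zero    = z≤n
        upto-peak (suc k) = max k
      -- The height hypothesis trades `fᵢ` for `fₙ` times `c`, and `b fₙ` is bounded by `M'` through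
      -- `leading`.
      bfᵢ : ∣ ℤ.- b ℤ.* coeff f i ∣ ≤ M' * c
      bfᵢ = begin
        ∣ ℤ.- b ℤ.* coeff f i ∣        ≡⟨ ℤₚ.abs-* (ℤ.- b) (coeff f i) ⟩
        ∣ ℤ.- b ∣ * ∣ coeff f i ∣       ≤⟨ ℕₚ.*-monoʳ-≤ ∣ ℤ.- b ∣ (proj₂ height i i<n) ⟩
        ∣ ℤ.- b ∣ * (∣ coeff f n ∣ * c) ≡⟨ ℕₚ.*-assoc ∣ ℤ.- b ∣ ∣ coeff f n ∣ c ⟨
        ∣ ℤ.- b ∣ * ∣ coeff f n ∣ * c   ≡⟨ cong (_* c) (ℤₚ.abs-* (ℤ.- b) (coeff f n)) ⟨
        ∣ ℤ.- b ℤ.* coeff f n ∣ * c    ≡⟨ cong (λ y → ∣ y ∣ * c) leading ⟨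
        ∣ coeff lhs n ∣ * c            ≤⟨ ℕₚ.*-monoˡ-≤ c lhs-n ⟩
        M' * c                        ∎
      isolate : + m ℤ.* coeff w' i ≡ coeff lhs i ℤ.- (e ℤ.* coeff w i ℤ.+ ℤ.- b ℤ.* coeff f i)
      isolate = trans (cancel (+ m ℤ.* coeff w' i) (e ℤ.* coeff w i ℤ.+ ℤ.- b ℤ.* coeff f i))
        (cong (λ y → y ℤ.- (e ℤ.* coeff w i ℤ.+ ℤ.- b ℤ.* coeff f i)) (sym (recurrence i)))
        where
        cancel : ∀ x y → x ≡ x ℤ.+ y ℤ.- y
        cancel = solve-∀
      -- Since `m = suc d + c`, both sides contain `M'` and `M' * c`; cancelling these leaves
      -- `d * M' < d * M`.
      mM' : suc d * M' + M' * c < M' + d * M + M' * c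
      mM' = begin-strict
        suc d * M' + M' * c    ≡⟨ cong (_+_ (suc d * M')) (ℕₚ.*-comm M' c) ⟩
        suc d * M' + c * M'    ≡⟨ ℕₚ.*-distribʳ-+ M' (suc d) c ⟨
        (suc d + c) * M'       ≡⟨ cong (_* M') (ℕₚ.m+[n∸m]≡n (proj₁ height)) ⟩
        m * M'                 ≡⟨ ℤₚ.abs-* (+ m) (coeff w' i) ⟨
        ∣ + m ℤ.* coeff w' i ∣  ≡⟨ cong ∣_∣ isolate ⟩
        ∣ coeff lhs i ℤ.- (e ℤ.* coeff w i ℤ.+ ℤ.- b ℤ.* coeff f i) ∣
          ≤⟨ ℤₚ.∣i-j∣≤∣i∣+∣j∣ (coeff lhs i) _ ⟩
        ∣ coeff lhs i ∣ + ∣ e ℤ.* coeff w i ℤ.+ ℤ.- b ℤ.* coeff f i ∣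
          ≤⟨ ℕₚ.+-monoʳ-≤ ∣ coeff lhs i ∣ (ℤₚ.∣i+j∣≤∣i∣+∣j∣ (e ℤ.* coeff w i) _) ⟩
        ∣ coeff lhs i ∣ + (∣ e ℤ.* coeff w i ∣ + ∣ ℤ.- b ℤ.* coeff f i ∣)
          <⟨ ℕₚ.+-mono-<-≤ lhs-i (ℕₚ.+-mono-≤ (w-bound i) bfᵢ) ⟩
        M' + (d * M + M' * c)  ≡⟨ ℕₚ.+-assoc M' (d * M) (M' * c) ⟨
        M' + d * M + M' * c    ∎
      dM'<dM : d * M' < d * M
      dM'<dM = ℕₚ.+-cancelˡ-< M' (d * M') (d * M) (ℕₚ.+-cancelʳ-< (M' * c) (M' + d * M') (M' + d * M) mM')

  -- Infinite descent from `v = 1`, where `h ⊛ v` is `h`. Its degree is below `n` because `g` is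
  -- nonconstant. If `∣ e ∣ ≤ d`, then each step yields another nonzero multiple of `h` of degree
  -- below `n`, with a strictly smaller bound on its coefficients.
  factor-value-bound : ¬ IsConstant g → d < ∣ e ∣
  factor-value-bound g-nonconstant = ℕₚ.≰⇒> contradiction
    where
    degrees = factor-degrees f g h f≈gh deg-f
    h≉0 : ¬ (h ≈ [])
    h≉0 h≈0 with degrees
    ... | _ , s , _ , (hₛ≢0 , _) , _ = hₛ≢0 (h≈0 s)
    h-high : ∀ i → n ≤ i → coeff h i ≡ + 0
    h-high i n≤i with degrees
    ... | zero  , s , (_ , g-high) , _            , _      = ⊥-elim (g-nonconstant (λ k → g-high (suc k) z<s))
    ... | suc r , s , _            , (_ , high) , refl = high i (ℕₚ.≤-trans (s≤s (ℕₚ.m≤n+m s r)) n≤i)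
    h1≈h : h ⊛ [ + 1 ] ≈ h
    h1≈h = eval-injective (h ⊛ [ + 1 ]) h λ x → trans (eval-⊛ h [ + 1 ] x)
      (trans (cong (eval h x ℤ.*_) (eval-constant (+ 1) x)) (ℤₚ.*-identityʳ (eval h x)))
    h1-high : ∀ i → n ≤ i → coeff (h ⊛ [ + 1 ]) i ≡ + 0
    h1-high i n≤i = trans (h1≈h i) (h-high i n≤i)

    descend : e ≢ + 0 → ∣ e ∣ ≤ d → ∀ M → Acc _<_ M → ∀ v → (∀ i → ∣ coeff (h ⊛ v) i ∣ ≤ M) →
      (∀ i → n ≤ i → coeff (h ⊛ v) i ≡ + 0) → ¬ (h ⊛ v ≈ []) → ⊥
    descend e≢0 e≤d M (acc below) v bound high hv≉0 = continue (descent-step v M high scaled nontrivial)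
      where
      scaled : ∀ i → ∣ e ℤ.* coeff (h ⊛ v) i ∣ ≤ d * M
      scaled i = ℕₚ.≤-trans (ℕₚ.≤-reflexive (ℤₚ.abs-* e (coeff (h ⊛ v) i))) (ℕₚ.*-mono-≤ e≤d (bound i))
      nontrivial : ¬ (eval v (+ m) ≡ + 0 × (∀ i → e ℤ.* coeff (h ⊛ v) i ≡ + 0))
      nontrivial (_ , ew≡0) = hv≉0 λ i →
        [ (λ e≡0 → ⊥-elim (e≢0 e≡0)) , (λ w≡0 → w≡0) ]′ (ℤₚ.i*j≡0⇒i≡0∨j≡0 e (ew≡0 i))
      continue : (∃ λ v' → (∀ i → n ≤ i → coeff (h ⊛ v') i ≡ + 0) × ¬ (h ⊛ v' ≈ []) ×
        ∃ λ M' → M' < M × (∀ i → ∣ coeff (h ⊛ v') i ∣ ≤ M')) → ⊥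
      continue (v' , high' , hv'≉0 , M' , M'<M , bound') =
        descend e≢0 e≤d M' (below M'<M) v' bound' high' hv'≉0

    -- For `e = 0` the term `e w` vanishes, so a single step may start from `M = 0`; it is
    -- nontrivial because `v = 1` does not vanish at `m`, and it would produce a bound below 0.
    e≢0 : e ≢ + 0
    e≢0 e≡0 = impossible (descent-step [ + 1 ] 0 h1-high scaled nontrivial)
      where
      scaled : ∀ i → ∣ e ℤ.* coeff (h ⊛ [ + 1 ]) i ∣ ≤ d * 0
      scaled i = ℕₚ.≤-trans (ℕₚ.≤-reflexive (cong (λ y → ∣ y ℤ.* coeff (h ⊛ [ + 1 ]) i ∣) e≡0)) z≤n
      nontrivial : ¬ (eval [ + 1 ] (+ m) ≡ + 0 × (∀ i → e ℤ.* coeff (h ⊛ [ + 1 ]) i ≡ + 0))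
      nontrivial (1≡0 , _) with () ← trans (sym (eval-constant (+ 1) (+ m))) 1≡0
      impossible : ¬ (∃ λ v' → (∀ i → n ≤ i → coeff (h ⊛ v') i ≡ + 0) × ¬ (h ⊛ v' ≈ []) ×
        ∃ λ M' → M' < 0 × (∀ i → ∣ coeff (h ⊛ v') i ∣ ≤ M'))
      impossible (_ , _ , _ , _ , () , _)

    contradiction : ¬ (∣ e ∣ ≤ d)
    contradiction e≤d with zero-or-peak (h ⊛ [ + 1 ])
    ... | inj₁ h1≈0 = h≉0 λ i → trans (sym (h1≈h i)) (h1≈0 i)
    ... | inj₂ (i , h1ᵢ≢0 , max , _) = descend e≢0 e≤d _ (<-wellFounded _) [ + 1 ] max h1-high
            (λ h1≈0 → h1ᵢ≢0 (h1≈0 i))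

-- Factorisation into irreducibles

zero? : ∀ p → Dec (p ≈ [])
zero? p with zero-or-degree p
... | inj₁ p≈0            = yes p≈0
... | inj₂ (r , pᵣ≢0 , _) = no λ p≈0 → pᵣ≢0 (p≈0 r)

infix 4 _≈?_
_≈?_ : ∀ p q → Dec (p ≈ q)
[]      ≈? q       = map′ (λ q≈0 → sym ∘ q≈0) (λ 0≈q → sym ∘ 0≈q) (zero? q)
(a ∷ p) ≈? []      = zero? (a ∷ p)
(a ∷ p) ≈? (b ∷ q) = map′
  (λ (a≡b , p≈q) → λ where
    zero    → a≡b
    (suc i) → p≈q i)
  (λ eq → eq 0 , eq ∘ suc) (a ℤ.≟ b ×-dec p ≈? q)

unit? : ∀ p → Dec (IsUnit p)
unit? p = (p ≈? [ + 1 ]) ⊎-dec (p ≈? [ -[1+ 0 ] ])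

constant? : ∀ p → Dec (IsConstant p)
constant? []      = yes λ _ → refl
constant? (a ∷ p) = zero? p

constant-≈ : ∀ p → IsConstant p → p ≈ [ coeff p 0 ]
constant-≈ p const zero    = refl
constant-≈ p const (suc i) = const i

eval-IsConstant : ∀ p → IsConstant p → ∀ x → eval p x ≡ coeff p 0
eval-IsConstant p const x =
  trans (eval-cong p [ coeff p 0 ] (constant-≈ p const) x) (eval-constant (coeff p 0) x)

eval-≈-⊛ : ∀ p g h → p ≈ g ⊛ h → ∀ x → eval p x ≡ eval g x ℤ.* eval h x
eval-≈-⊛ p g h p≈gh x = trans (eval-cong p (g ⊛ h) p≈gh x) (eval-⊛ g h x)

∣i∣≡1⇒i≡±1 : ∀ i → ∣ i ∣ ≡ 1 → i ≡ + 1 ⊎ i ≡ -[1+ 0 ]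
∣i∣≡1⇒i≡±1 (+ 1)     refl = inj₁ refl
∣i∣≡1⇒i≡±1 -[1+ 0 ]  refl = inj₂ refl

integersUpTo : ℕ → List ℤ
integersUpTo B = map +_ (upTo (suc B)) ++ map (λ k → ℤ.- + k) (upTo (suc B))

∈-integersUpTo : ∀ {B} a → ∣ a ∣ ≤ B → a ∈ integersUpTo B
∈-integersUpTo {B} (+ k)    k≤B = ∈-++⁺ˡ (∈-map⁺ +_ (∈-upTo⁺ (s≤s k≤B)))
∈-integersUpTo {B} -[1+ k ] k<B = ∈-++⁺ʳ (map +_ (upTo (suc B))) (∈-map⁺ (λ k → ℤ.- + k) (∈-upTo⁺ (s≤s k<B)))

polysUpTo : ℕ → ℕ → List Poly
polysUpTo B zero    = [ [] ]
polysUpTo B (suc l) = cartesianProductWith _∷_ (integersUpTo B) (polysUpTo B l)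

∈-polysUpTo : ∀ {B} p → (∀ i → ∣ coeff p i ∣ ≤ B) → p ∈ polysUpTo B (length p)
∈-polysUpTo []      bound = here refl
∈-polysUpTo (a ∷ p) bound = ∈-cartesianProductWith⁺ _∷_ (∈-integersUpTo a (bound 0)) (∈-polysUpTo p (bound ∘ suc))

coeff-applyUpTo : ∀ (a : ℕ → ℤ) l → (∀ i → l ≤ i → a i ≡ + 0) → ∀ i → coeff (applyUpTo a l) i ≡ a i
coeff-applyUpTo a zero    high i       = sym (high i z≤n)
coeff-applyUpTo a (suc l) high zero    = refl
coeff-applyUpTo a (suc l) high (suc i) = coeff-applyUpTo (a ∘ suc) l (λ k l≤k → high (suc k) (s≤s l≤k)) i

common-bound : ∀ (a : ℕ → ℕ) l → ∃ λ B → ∀ i → i < l → a i ≤ B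
common-bound a zero    = 0 , λ _ ()
common-bound a (suc l) with common-bound (a ∘ suc) l
... | B , bound = a 0 + B , λ where
  zero    _         → ℕₚ.m≤m+n (a 0) B
  (suc i) (s≤s i<l) → ℕₚ.≤-trans (bound i i<l) (ℕₚ.m≤n+m B (a 0))

Divides : Poly → Poly → Set
Divides g f = ∃ λ h → f ≈ g ⊛ h

divides-left : ∀ f g h q → Divides q f → q ≈ g ⊛ h → Divides g f
divides-left f g h q (r , f≈qr) q≈gh = h ⊛ r , eval-injective f (g ⊛ (h ⊛ r)) λ x → begin
  eval f x                             ≡⟨ eval-≈-⊛ f q r f≈qr x ⟩
  eval q x ℤ.* eval r x                ≡⟨ cong (ℤ._* eval r x) (eval-≈-⊛ q g h q≈gh x) ⟩
  eval g x ℤ.* eval h x ℤ.* eval r x   ≡⟨ ℤₚ.*-assoc (eval g x) (eval h x) (eval r x) ⟩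
  eval g x ℤ.* (eval h x ℤ.* eval r x) ≡⟨ cong (eval g x ℤ.*_) (eval-⊛ h r x) ⟨
  eval g x ℤ.* eval (h ⊛ r) x          ≡⟨ eval-⊛ g (h ⊛ r) x ⟨
  eval (g ⊛ (h ⊛ r)) x                 ∎
  where open ≡-Reasoning

⊛-comm : ∀ g h → g ⊛ h ≈ h ⊛ g
⊛-comm g h = eval-injective (g ⊛ h) (h ⊛ g) λ x →
  trans (eval-⊛ g h x) (trans (ℤₚ.*-comm (eval g x) (eval h x)) (sym (eval-⊛ h g x)))

divides-right : ∀ f g h q → Divides q f → q ≈ g ⊛ h → Divides h f
divides-right f g h q q∣f q≈gh = divides-left f h g q q∣f (λ i → trans (q≈gh i) (⊛-comm g h i))

divides-prod : ∀ f gs → Divides (prod gs) f → All (λ g → Divides g f) gs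
divides-prod f []       _      = []
divides-prod f (g ∷ gs) prod∣f =
    divides-left f g (prod gs) (g ⊛ prod gs) prod∣f (λ _ → refl)
  ∷ divides-prod f gs (divides-right f g (prod gs) (g ⊛ prod gs) prod∣f (λ _ → refl))

divides-refl : ∀ f → Divides f f
divides-refl f = [ + 1 ] , eval-injective f (f ⊛ [ + 1 ]) λ x → sym (trans (eval-⊛ f [ + 1 ] x)
  (trans (cong (eval f x ℤ.*_) (eval-constant (+ 1) x)) (ℤₚ.*-identityʳ (eval f x))))

eval-divides : ∀ f g → Divides g f → ∀ x → ∣ eval g x ∣ ∣ ∣ eval f x ∣
eval-divides f g (h , f≈gh) x = divides ∣ eval h x ∣
  (trans (cong ∣_∣ (eval-≈-⊛ f g h f≈gh x))
    (trans (ℤₚ.abs-* (eval g x) (eval h x)) (ℕₚ.*-comm ∣ eval g x ∣ ∣ eval h x ∣)))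

eval-prod-++ : ∀ gs hs x → eval (prod (gs ++ hs)) x ≡ eval (prod gs) x ℤ.* eval (prod hs) x
eval-prod-++ []       hs x = sym (trans (cong (ℤ._* eval (prod hs) x) (eval-constant (+ 1) x)) (ℤₚ.*-identityˡ (eval (prod hs) x)))
eval-prod-++ (g ∷ gs) hs x = begin
  eval (g ⊛ prod (gs ++ hs)) x                                ≡⟨ eval-⊛ g (prod (gs ++ hs)) x ⟩
  eval g x ℤ.* eval (prod (gs ++ hs)) x                       ≡⟨ cong (eval g x ℤ.*_) (eval-prod-++ gs hs x) ⟩
  eval g x ℤ.* (eval (prod gs) x ℤ.* eval (prod hs) x)        ≡⟨ ℤₚ.*-assoc (eval g x) (eval (prod gs) x) (eval (prod hs) x) ⟨
  eval g x ℤ.* eval (prod gs) x ℤ.* eval (prod hs) x          ≡⟨ cong (ℤ._* eval (prod hs) x) (eval-⊛ g (prod gs) x) ⟨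
  eval (g ⊛ prod gs) x ℤ.* eval (prod hs) x                   ∎
  where open ≡-Reasoning

-- No bound on the number of factors yet: that bound is derived afterwards from the values of the
-- factors at `m`. Constant factors are all absorbed in `c`.
Factorisation : Poly → Set
Factorisation p = ∃ λ c → ∃ λ gs →
  All (λ g → Irreducible g × ¬ IsConstant g) gs × p ≈ [ c ] ⊛ prod gs

factorisation-⊛ : ∀ p g h → p ≈ g ⊛ h → Factorisation g → Factorisation h → Factorisation p
factorisation-⊛ p g h p≈gh (b , gs , all-gs , g≈) (c , hs , all-hs , h≈) =
  b ℤ.* c , gs ++ hs , Allₚ.++⁺ all-gs all-hs , eval-injective p ([ b ℤ.* c ] ⊛ prod (gs ++ hs)) λ x → begin
    eval p x                                           ≡⟨ eval-≈-⊛ p g h p≈gh x ⟩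
    eval g x ℤ.* eval h x                              ≡⟨ cong₂ ℤ._*_ (eval-part g b gs g≈ x) (eval-part h c hs h≈ x) ⟩
    (b ℤ.* eval (prod gs) x) ℤ.* (c ℤ.* eval (prod hs) x)  ≡⟨ interchange b (eval (prod gs) x) c (eval (prod hs) x) ⟩
    b ℤ.* c ℤ.* (eval (prod gs) x ℤ.* eval (prod hs) x)    ≡⟨ cong₂ ℤ._*_ (eval-constant (b ℤ.* c) x) (eval-prod-++ gs hs x) ⟨
    eval [ b ℤ.* c ] x ℤ.* eval (prod (gs ++ hs)) x    ≡⟨ eval-⊛ [ b ℤ.* c ] (prod (gs ++ hs)) x ⟨
    eval ([ b ℤ.* c ] ⊛ prod (gs ++ hs)) x             ∎
  where
  open ≡-Reasoning
  interchange : ∀ b u c v → (b ℤ.* u) ℤ.* (c ℤ.* v) ≡ b ℤ.* c ℤ.* (u ℤ.* v)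
  interchange = solve-∀
  eval-part : ∀ q c qs → q ≈ [ c ] ⊛ prod qs → ∀ x → eval q x ≡ c ℤ.* eval (prod qs) x
  eval-part q c qs q≈ x =
    trans (eval-≈-⊛ q [ c ] (prod qs) q≈ x) (cong (ℤ._* eval (prod qs) x) (eval-constant c x))

factorisation-constant : ∀ p → IsConstant p → Factorisation p
factorisation-constant p const = coeff p 0 , [] , [] , eval-injective p ([ coeff p 0 ] ⊛ [ + 1 ]) λ x →
  trans (eval-IsConstant p const x) (sym (trans (eval-⊛ [ coeff p 0 ] [ + 1 ] x)
    (trans (cong₂ ℤ._*_ (eval-constant (coeff p 0) x) (eval-constant (+ 1) x)) (ℤₚ.*-identityʳ (coeff p 0)))))

factorisation-irreducible : ∀ p → Irreducible p → ¬ IsConstant p → Factorisation p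
factorisation-irreducible p irr nonconst = + 1 , [ p ] , (irr , nonconst) ∷ [] , eval-injective p ([ + 1 ] ⊛ (p ⊛ [ + 1 ])) λ x →
  sym (trans (eval-⊛ [ + 1 ] (p ⊛ [ + 1 ]) x)
    (trans (cong₂ ℤ._*_ (eval-constant (+ 1) x) (trans (eval-⊛ p [ + 1 ] x) (cong (eval p x ℤ.*_) (eval-constant (+ 1) x))))
      (trans (ℤₚ.*-identityˡ (eval p x ℤ.* + 1)) (ℤₚ.*-identityʳ (eval p x)))))

-- Lets the bound on values of factors be applied at `m + i` as well as at `m`, as the interpolation
-- points of Kronecker's method require.
HeightBound-mono : ∀ f n {m m' d} → m ≤ m' → HeightBound f n m d → HeightBound f n m' d
HeightBound-mono f n {d = d} m≤m' (d<m , bound) =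
  ℕₚ.≤-trans d<m m≤m' , λ i i<n →
    ℕₚ.≤-trans (bound i i<n) (ℕₚ.*-monoʳ-≤ ∣ coeff f n ∣ (ℕₚ.∸-monoˡ-≤ (suc d) m≤m'))

module _ (f : Poly) (n m d : ℕ) (deg-f : HasDegree f n) (f₀≢0 : coeff f 0 ≢ + 0)
  (height : HeightBound f n m d) where

  -- A nonconstant `f` is a factor of itself, so its value exceeds `d` in absolute value; a constant
  -- `f` equals its nonzero constant term.
  eval-nonzero : ∀ i → eval f (+ (m + i)) ≢ + 0
  eval-nonzero i with constant? f
  ... | yes const = λ f≡0 → f₀≢0 (trans (sym (eval-IsConstant f const (+ (m + i)))) f≡0)
  ... | no nonconst with divides-refl f
  ...   | h , f≈fh = λ f≡0 → ℕₚ.n≮0 (subst (λ y → d < ∣ y ∣) f≡0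
            (factor-value-bound f f h n (m + i) d f≈fh deg-f (HeightBound-mono f n (ℕₚ.m≤m+n m i) height) nonconst))

  eval-factor-≤ : ∀ g → Divides g f → ∀ i → ∣ eval g (+ (m + i)) ∣ ≤ ∣ eval f (+ (m + i)) ∣
  eval-factor-≤ g g∣f i = ∣⇒≤ {{≢-nonZero (eval-nonzero i ∘ ℤₚ.∣i∣≡0⇒i≡0)}} (eval-divides f g g∣f (+ (m + i)))

  -- The values of a factor at `m`, ..., `m + n` divide the nonzero values of `f` there, so they are
  -- bounded, and with them the coefficients. Factors are listed only up to `_≈_`, since trailing
  -- zeros give each infinitely many lists.
  factor-candidates : ∃ λ L → ∀ g → Divides g f → ∃ λ g' → g' ∈ L × g ≈ g'
  factor-candidates with common-bound (λ i → ∣ eval f (+ (m + i)) ∣) (suc n)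
  ... | B , values = polysUpTo K (suc n) , representative
    where
    K : ℕ
    K = coeffBound (suc n) m B
    representative : ∀ g → Divides g f → ∃ λ g' → g' ∈ polysUpTo K (suc n) × g ≈ g'
    representative g (h , f≈gh) with factor-degrees f g h f≈gh deg-f
    ... | r , s , (_ , high) , _ , r+s≡n = g' , g'∈ , λ i → sym (g'≈g i)
      where
      -- The factor is rewritten as a list of exactly `suc n` entries, which is possible because its
      -- degree is at most `n`; this fixes the number of interpolation points.
      g' : Poly
      g' = applyUpTo (coeff g) (suc n)
      g'≈g : g' ≈ g
      g'≈g = coeff-applyUpTo (coeff g) (suc n) λ i n<i →
        high i (ℕₚ.≤-trans (s≤s (subst (r ≤_) r+s≡n (ℕₚ.m≤m+n r s))) n<i)
      g'-length : length g' ≡ suc n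
      g'-length = length-applyUpTo (coeff g) (suc n)
      g'-bound : ∀ i → ∣ coeff g' i ∣ ≤ K
      g'-bound = ∣coeff∣≤coeffBound (suc n) g' m B g'-length λ i i≤n →
        ℕₚ.≤-trans (ℕₚ.≤-reflexive (cong ∣_∣ (eval-cong g' g g'≈g (+ (m + i)))))
          (ℕₚ.≤-trans (eval-factor-≤ g (h , f≈gh) i) (values i i≤n))
      g'∈ : g' ∈ polysUpTo K (suc n)
      g'∈ = subst (λ l → g' ∈ polysUpTo K l) g'-length (∈-polysUpTo g' g'-bound)

  nonconstant-factor-value : ∀ g → Divides g f → ¬ IsConstant g → d < ∣ eval g (+ m) ∣
  nonconstant-factor-value g (h , f≈gh) = factor-value-bound f g h n m d f≈gh deg-f height

  module _ (d>0 : 0 < d) where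

    -- A nonconstant factor has a value beyond `d`, which is at least 1. A constant factor is its
    -- own value, nonzero because `f(m)` is, and different from 1 and -1 because it is no unit.
    nonunit-value : ∀ g → Divides g f → ¬ IsUnit g → 1 < ∣ eval g (+ m) ∣
    nonunit-value g g∣f nonunit with constant? g
    ... | no nonconst = ℕₚ.≤-trans (s≤s d>0) (nonconstant-factor-value g g∣f nonconst)
    ... | yes const = ℕₚ.≤∧≢⇒< (∣i∣>0 value≢0) (λ 1≡ → value≢1 (sym 1≡))
      where
      value≡ : eval g (+ m) ≡ coeff g 0
      value≡ = eval-IsConstant g const (+ m)
      value≢0 : eval g (+ m) ≢ + 0
      value≢0 g≡0 = eval-nonzero 0 (subst (λ k → eval f (+ k) ≡ + 0) (sym (ℕₚ.+-identityʳ m))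
        (ℤₚ.∣i∣≡0⇒i≡0 (0∣⇒≡0 (subst (λ y → ∣ y ∣ ∣ ∣ eval f (+ m) ∣) g≡0 (eval-divides f g g∣f (+ m))))))
      value≢1 : ∣ eval g (+ m) ∣ ≢ 1
      value≢1 g≡1 = nonunit (Sum.map constant constant (∣i∣≡1⇒i≡±1 (coeff g 0) (trans (cong ∣_∣ (sym value≡)) g≡1)))
        where
        constant : ∀ {c} → coeff g 0 ≡ c → g ≈ [ c ]
        constant refl = constant-≈ g const

    ProperSplit : Poly → Poly → Poly → Set
    ProperSplit p g h = p ≈ g ⊛ h × ¬ IsUnit g × ¬ IsUnit h

    -- Every factor of `p` also divides `f`, so the one finite list of candidates for `f` serves for
    -- the search in each `p`.
    split-or-irreducible : ∀ p → Divides p f →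
      (∃ λ g → ∃ λ h → ProperSplit p g h) ⊎ (∀ g h → p ≈ g ⊛ h → IsUnit g ⊎ IsUnit h)
    split-or-irreducible p p∣f with factor-candidates
    ... | L , represent with any? (λ g → any? (λ h → p ≈? g ⊛ h ×-dec ¬? (unit? g) ×-dec ¬? (unit? h)) L) L
    ...   | yes found with find found
    ...     | g , _ , found-h with find found-h
    ...       | h , _ , split = inj₁ (g , h , split)
    split-or-irreducible p p∣f | L , represent | no none = inj₂ irreducible
      where
      unit-cong : ∀ g g' → g ≈ g' → IsUnit g' → IsUnit g
      unit-cong g g' g≈g' = Sum.map (λ eq i → trans (g≈g' i) (eq i)) (λ eq i → trans (g≈g' i) (eq i))
      irreducible : ∀ g h → p ≈ g ⊛ h → IsUnit g ⊎ IsUnit h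
      irreducible g h p≈gh with unit? g | unit? h
      ... | yes unit-g | _          = inj₁ unit-g
      ... | no _       | yes unit-h = inj₂ unit-h
      ... | no ¬unit-g | no ¬unit-h
        with represent g (divides-left f g h p p∣f p≈gh) | represent h (divides-right f g h p p∣f p≈gh)
      ...   | g' , g'∈L , g≈g' | h' , h'∈L , h≈h' =
        ⊥-elim (none (lose g'∈L (lose h'∈L (p≈g'h' , ¬unit-g ∘ unit-cong g g' g≈g' , ¬unit-h ∘ unit-cong h h' h≈h'))))
        where
        p≈g'h' : p ≈ g' ⊛ h'
        p≈g'h' = eval-injective p (g' ⊛ h') λ x → trans (eval-≈-⊛ p g h p≈gh x)
          (trans (cong₂ ℤ._*_ (eval-cong g g' g≈g' x) (eval-cong h h' h≈h' x)) (sym (eval-⊛ g' h' x)))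

    -- In a proper split both values at `m` exceed 1 in absolute value, so each is strictly smaller
    -- than their product, the value of `p`.
    factorise : ∀ p → Acc _<_ ∣ eval p (+ m) ∣ → Divides p f → Factorisation p
    factorise p (acc below) p∣f with constant? p
    ... | yes const = factorisation-constant p const
    ... | no nonconst with split-or-irreducible p p∣f
    ...   | inj₂ irreducible = factorisation-irreducible p
              ((λ p≈0 → nonconst (p≈0 ∘ suc)) , [ (λ p≈1 → nonconst (p≈1 ∘ suc)) , (λ p≈-1 → nonconst (p≈-1 ∘ suc)) ]′ , irreducible)
              nonconst
    ...   | inj₁ (g , h , p≈gh , ¬unit-g , ¬unit-h) =
              factorisation-⊛ p g h p≈gh (factorise g (below g<p) g∣f) (factorise h (below h<p) h∣f)
      where
      g∣f : Divides g f
      g∣f = divides-left f g h p p∣f p≈gh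
      h∣f : Divides h f
      h∣f = divides-right f g h p p∣f p≈gh
      G H : ℕ
      G = ∣ eval g (+ m) ∣
      H = ∣ eval h (+ m) ∣
      G>1 : 1 < G
      G>1 = nonunit-value g g∣f ¬unit-g
      H>1 : 1 < H
      H>1 = nonunit-value h h∣f ¬unit-h
      GH≡ : G * H ≡ ∣ eval p (+ m) ∣
      GH≡ = sym (trans (cong ∣_∣ (eval-≈-⊛ p g h p≈gh (+ m))) (ℤₚ.abs-* (eval g (+ m)) (eval h (+ m))))
      g<p : G < ∣ eval p (+ m) ∣
      g<p = subst (G <_) GH≡ (ℕₚ.m<m*n G H {{>-nonZero (ℕₚ.<⇒≤ G>1)}} H>1)
      h<p : H < ∣ eval p (+ m) ∣
      h<p = subst (H <_) (trans (ℕₚ.*-comm H G) GH≡) (ℕₚ.m<m*n H G {{>-nonZero (ℕₚ.<⇒≤ H>1)}} G>1)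

-- Taylor coefficients modulo a prime

-- taylor x j p is the coefficient of yʲ in p(x + y).
taylor : ℤ → ℕ → Poly → ℤ
taylor x j       []      = + 0
taylor x zero    (a ∷ p) = a ℤ.+ x ℤ.* taylor x zero p
taylor x (suc j) (a ∷ p) = x ℤ.* taylor x (suc j) p ℤ.+ taylor x j p

taylor-zero : ∀ x p → taylor x 0 p ≡ eval p x
taylor-zero x []      = refl
taylor-zero x (a ∷ p) = cong (λ u → a ℤ.+ x ℤ.* u) (taylor-zero x p)

taylor-⊕ : ∀ x j p q → taylor x j (p ⊕ q) ≡ taylor x j p ℤ.+ taylor x j q
taylor-⊕ x j       []      q       = sym (ℤₚ.+-identityˡ _)
taylor-⊕ x j       (a ∷ p) []      = sym (ℤₚ.+-identityʳ _)
taylor-⊕ x zero    (a ∷ p) (b ∷ q) rewrite taylor-⊕ x zero p q = regroup a b x (taylor x 0 p) (taylor x 0 q)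
  where
  regroup : ∀ a b x u v → (a ℤ.+ b) ℤ.+ x ℤ.* (u ℤ.+ v) ≡ (a ℤ.+ x ℤ.* u) ℤ.+ (b ℤ.+ x ℤ.* v)
  regroup = solve-∀
taylor-⊕ x (suc j) (a ∷ p) (b ∷ q) rewrite taylor-⊕ x (suc j) p q | taylor-⊕ x j p q =
  regroup x (taylor x (suc j) p) (taylor x (suc j) q) (taylor x j p) (taylor x j q)
  where
  regroup : ∀ x u v s t → x ℤ.* (u ℤ.+ v) ℤ.+ (s ℤ.+ t) ≡ (x ℤ.* u ℤ.+ s) ℤ.+ (x ℤ.* v ℤ.+ t)
  regroup = solve-∀

taylor-scale : ∀ x j c p → taylor x j (scale c p) ≡ c ℤ.* taylor x j p
taylor-scale x j       c []      = sym (ℤₚ.*-zeroʳ c)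
taylor-scale x zero    c (a ∷ p) rewrite taylor-scale x zero c p = regroup c a x (taylor x 0 p)
  where
  regroup : ∀ c a x u → c ℤ.* a ℤ.+ x ℤ.* (c ℤ.* u) ≡ c ℤ.* (a ℤ.+ x ℤ.* u)
  regroup = solve-∀
taylor-scale x (suc j) c (a ∷ p) rewrite taylor-scale x (suc j) c p | taylor-scale x j c p =
  regroup c x (taylor x (suc j) p) (taylor x j p)
  where
  regroup : ∀ c x u v → x ℤ.* (c ℤ.* u) ℤ.+ c ℤ.* v ≡ c ℤ.* (x ℤ.* u ℤ.+ v)
  regroup = solve-∀

taylor-≈[] : ∀ x j p → p ≈ [] → taylor x j p ≡ + 0
taylor-≈[] x j       []      _   = refl
taylor-≈[] x zero    (a ∷ p) p≈0 rewrite p≈0 0 | taylor-≈[] x zero p (p≈0 ∘ suc) =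
  trans (ℤₚ.+-identityˡ _) (ℤₚ.*-zeroʳ x)
taylor-≈[] x (suc j) (a ∷ p) p≈0 rewrite taylor-≈[] x (suc j) p (p≈0 ∘ suc) | taylor-≈[] x j p (p≈0 ∘ suc) =
  trans (ℤₚ.+-identityʳ _) (ℤₚ.*-zeroʳ x)

taylor-cong : ∀ x j p q → p ≈ q → taylor x j p ≡ taylor x j q
taylor-cong x j       []      q       p≈q = sym (taylor-≈[] x j q (sym ∘ p≈q))
taylor-cong x j       (a ∷ p) []      p≈q = taylor-≈[] x j (a ∷ p) p≈q
taylor-cong x zero    (a ∷ p) (b ∷ q) p≈q =
  cong₂ (λ c u → c ℤ.+ x ℤ.* u) (p≈q 0) (taylor-cong x zero p q (p≈q ∘ suc))
taylor-cong x (suc j) (a ∷ p) (b ∷ q) p≈q =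
  cong₂ (λ u v → x ℤ.* u ℤ.+ v) (taylor-cong x (suc j) p q (p≈q ∘ suc)) (taylor-cong x j p q (p≈q ∘ suc))

taylor-cons-⊛ : ∀ x j a p q →
  taylor x j ((a ∷ p) ⊛ q) ≡ a ℤ.* taylor x j q ℤ.+ taylor x j (+ 0 ∷ (p ⊛ q))
taylor-cons-⊛ x j a p q = trans (taylor-⊕ x j (scale a q) (+ 0 ∷ (p ⊛ q)))
  (cong (ℤ._+ taylor x j (+ 0 ∷ (p ⊛ q))) (taylor-scale x j a q))

module _ (P x : ℤ) where

  -- Membership of `q` in the ideal generated by `P` and the `s`-th power of the monic linear
  -- polynomial with root `x`.
  VanishesMod : ℕ → Poly → Set
  VanishesMod s q = ∀ i → i < s → P ∣ᶻ taylor x i q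

  vanishes-⊛ : ∀ s p q → VanishesMod s q → VanishesMod s (p ⊛ q)
  vanishes-⊛ s []      q van i       i<s = ℤ∣.divides (+ 0) refl
  vanishes-⊛ s (a ∷ p) q van i       i<s = subst (P ∣ᶻ_) (sym (taylor-cons-⊛ x i a p q))
    (ℤ∣.∣m∣n⇒∣m+n (ℤ∣.∣n⇒∣m*n a (van i i<s)) (shifted i i<s))
    where
    shifted : ∀ i → i < s → P ∣ᶻ taylor x i (+ 0 ∷ (p ⊛ q))
    shifted zero    0<s = subst (P ∣ᶻ_) (sym (ℤₚ.+-identityˡ _)) (ℤ∣.∣n⇒∣m*n x (vanishes-⊛ s p q van 0 0<s))
    shifted (suc i) i<s = ℤ∣.∣m∣n⇒∣m+n (ℤ∣.∣n⇒∣m*n x (vanishes-⊛ s p q van (suc i) i<s))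
      (vanishes-⊛ s p q van i (ℕₚ.<⇒≤ i<s))

  -- In the convolution for coefficient `s` of the product, every term but one contains a lower
  -- Taylor coefficient of `q`, hence is zero modulo `P`; what remains is the constant Taylor
  -- coefficient of `p` times coefficient `s` of `q`.
  taylor-⊛-mod : ∀ s p q → VanishesMod s q →
    P ∣ᶻ taylor x s (p ⊛ q) ℤ.- eval p x ℤ.* taylor x s q
  taylor-⊛-mod s       []      q van = ℤ∣.divides (+ 0) refl
  taylor-⊛-mod zero    (a ∷ p) q van rewrite taylor-cons-⊛ x 0 a p q = subst (P ∣ᶻ_)
    (regroup a x (taylor x 0 q) (eval p x) (taylor x 0 (p ⊛ q))) (ℤ∣.∣n⇒∣m*n x (taylor-⊛-mod zero p q van))
    where
    regroup : ∀ a x t u v → x ℤ.* (v ℤ.- u ℤ.* t) ≡ a ℤ.* t ℤ.+ (+ 0 ℤ.+ x ℤ.* v) ℤ.- (a ℤ.+ x ℤ.* u) ℤ.* t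
    regroup = solve-∀
  taylor-⊛-mod (suc s) (a ∷ p) q van rewrite taylor-cons-⊛ x (suc s) a p q = subst (P ∣ᶻ_)
    (regroup a x (taylor x (suc s) q) (eval p x) (taylor x (suc s) (p ⊛ q)) (taylor x s (p ⊛ q)))
    (ℤ∣.∣m∣n⇒∣m+n (ℤ∣.∣n⇒∣m*n x (taylor-⊛-mod (suc s) p q van)) (vanishes-⊛ (suc s) p q van s ℕₚ.≤-refl))
    where
    regroup : ∀ a x t u v w → x ℤ.* (v ℤ.- u ℤ.* t) ℤ.+ w ≡ a ℤ.* t ℤ.+ (x ℤ.* v ℤ.+ w) ℤ.- (a ℤ.+ x ℤ.* u) ℤ.* t
    regroup = solve-∀

  -- Each factor whose value at `x` is divisible by `P` raises the order of vanishing by one: the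
  -- lower coefficients stay divisible, and the next one is `g(x)` times an integer modulo `P`.
  vanishes-prod : ∀ gs → All (λ g → P ∣ᶻ eval g x) gs → VanishesMod (length gs) (prod gs)
  vanishes-prod []       []            i ()
  vanishes-prod (g ∷ gs) (P∣g ∷ P∣gs) i (s≤s i≤s) with ℕₚ.m≤n⇒m<n∨m≡n i≤s
  ... | inj₁ i<s  = vanishes-⊛ (length gs) g (prod gs) (vanishes-prod gs P∣gs) i i<s
  ... | inj₂ refl = ℤ∣.∣m+n∣n⇒∣m (taylor-⊛-mod (length gs) g (prod gs) (vanishes-prod gs P∣gs))
    (ℤ∣.∣m⇒∣-m (ℤ∣.∣m⇒∣m*n (taylor x (length gs) (prod gs)) P∣g))

-- Defs.deriv-from is private; abstracting the literal 1 in the unfolding of deriv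
-- lets unification recover it.
mutual
  deriv-from : ℕ → Poly → Poly
  deriv-from = _

  deriv-cons : ∀ a p → deriv (a ∷ p) ≡ deriv-from 1 p
  deriv-cons a p with 1
  ... | k = deriv-from-unfolds a k p

  deriv-from-unfolds : ∀ (a : ℤ) k p → _ ≡ deriv-from k p
  deriv-from-unfolds a k p = refl

-- For `k = 0` this is the product rule `(x p)' = x p' + p`.
deriv-from-suc : ∀ k p → deriv-from (suc k) p ≡ deriv-from k p ⊕ p
deriv-from-suc k []      = refl
deriv-from-suc k (a ∷ p) = cong₂ _∷_ (regroup (+ k) a) (deriv-from-suc (suc k) p)
  where
  regroup : ∀ c a → (+ 1 ℤ.+ c) ℤ.* a ≡ c ℤ.* a ℤ.+ a
  regroup = solve-∀

-- Both lists represent `x p'`. They differ as lists when `p` is empty, so they are compared through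
-- their Taylor coefficients.
taylor-deriv-from-zero : ∀ x j p → taylor x j (deriv-from 0 p) ≡ taylor x j (+ 0 ∷ deriv p)
taylor-deriv-from-zero x zero    []      = sym (trans (ℤₚ.+-identityˡ _) (ℤₚ.*-zeroʳ x))
taylor-deriv-from-zero x (suc j) []      = sym (trans (ℤₚ.+-identityʳ _) (ℤₚ.*-zeroʳ x))
taylor-deriv-from-zero x j       (a ∷ p) =
  cong (taylor x j) (cong₂ _∷_ (ℤₚ.*-zeroˡ a) (sym (deriv-cons a p)))

taylor-deriv : ∀ x j p → taylor x j (deriv p) ≡ + suc j ℤ.* taylor x (suc j) p
taylor-deriv x j []      = sym (ℤₚ.*-zeroʳ (+ suc j))
taylor-deriv x j (a ∷ p) = begin
  taylor x j (deriv (a ∷ p))                       ≡⟨ cong (taylor x j) (trans (deriv-cons a p) (deriv-from-suc 0 p)) ⟩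
  taylor x j (deriv-from 0 p ⊕ p)                  ≡⟨ taylor-⊕ x j (deriv-from 0 p) p ⟩
  taylor x j (deriv-from 0 p) ℤ.+ taylor x j p     ≡⟨ cong (ℤ._+ taylor x j p) (taylor-deriv-from-zero x j p) ⟩
  taylor x j (+ 0 ∷ deriv p) ℤ.+ taylor x j p      ≡⟨ product-rule j ⟩
  + suc j ℤ.* taylor x (suc j) (a ∷ p)             ∎
  where
  open ≡-Reasoning
  product-rule : ∀ j → taylor x j (+ 0 ∷ deriv p) ℤ.+ taylor x j p ≡ + suc j ℤ.* taylor x (suc j) (a ∷ p)
  product-rule zero    rewrite taylor-deriv x 0 p = regroup x (taylor x 1 p) (taylor x 0 p)
    where
    regroup : ∀ x u v → (+ 0 ℤ.+ x ℤ.* (+ 1 ℤ.* u)) ℤ.+ v ≡ + 1 ℤ.* (x ℤ.* u ℤ.+ v)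
    regroup = solve-∀
  product-rule (suc i) rewrite taylor-deriv x (suc i) p | taylor-deriv x i p =
    regroup x (+ suc i) (taylor x (suc (suc i)) p) (taylor x (suc i) p)
    where
    regroup : ∀ x c u v →
      (x ℤ.* ((+ 1 ℤ.+ c) ℤ.* u) ℤ.+ c ℤ.* v) ℤ.+ v ≡ (+ 1 ℤ.+ c) ℤ.* (x ℤ.* u ℤ.+ v)
    regroup = solve-∀

-- The index `i` is kept general because each derivative removed raises it by one; the case `i = 0`
-- says that the `j`-th derivative at `x` is `j !` times a Taylor coefficient.
taylor-deriv^ : ∀ x f j i → + (i !) ℤ.* taylor x i (deriv^ j f) ≡ + ((j + i) !) ℤ.* taylor x (j + i) f
taylor-deriv^ x f zero    i = refl
taylor-deriv^ x f (suc j) i = begin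
  + (i !) ℤ.* taylor x i (deriv (deriv^ j f))                ≡⟨ cong (+ (i !) ℤ.*_) (taylor-deriv x i (deriv^ j f)) ⟩
  + (i !) ℤ.* (+ suc i ℤ.* taylor x (suc i) (deriv^ j f))    ≡⟨ regroup (+ (i !)) (+ suc i) (taylor x (suc i) (deriv^ j f)) ⟩
  (+ suc i ℤ.* + (i !)) ℤ.* taylor x (suc i) (deriv^ j f)    ≡⟨ cong (ℤ._* taylor x (suc i) (deriv^ j f)) (ℤₚ.pos-* (suc i) (i !)) ⟨
  + (suc i !) ℤ.* taylor x (suc i) (deriv^ j f)              ≡⟨ taylor-deriv^ x f j (suc i) ⟩
  + ((j + suc i) !) ℤ.* taylor x (j + suc i) f               ≡⟨ cong (λ l → + (l !) ℤ.* taylor x l f) (ℕₚ.+-suc j i) ⟩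
  + ((suc j + i) !) ℤ.* taylor x (suc j + i) f               ∎
  where
  open ≡-Reasoning
  regroup : ∀ a b c → a ℤ.* (b ℤ.* c) ≡ (b ℤ.* a) ℤ.* c
  regroup = solve-∀

-- `d` times the error of the quotient equals the remainder, which is smaller than `d`; so the error
-- is zero.
/ℕ-exact : ∀ d q .{{_ : NonZero d}} → (+ d ℤ.* q) ℤ./ℕ d ≡ q
/ℕ-exact d q = sym (ℤₚ.i-j≡0⇒i≡j q q' (ℤₚ.∣i∣≡0⇒i≡0 (ℕₚ.n<1⇒n≡0 (ℕₚ.*-cancelˡ-< d ∣ q ℤ.- q' ∣ 1 small))))
  where
  q' = (+ d ℤ.* q) ℤ./ℕ d
  r  = (+ d ℤ.* q) ℤ.%ℕ d
  remainder : + d ℤ.* (q ℤ.- q') ≡ + r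
  remainder = trans (distribute (+ d) q q')
    (trans (cong (ℤ._- q' ℤ.* + d) (ℤ-DivMod.a≡a%ℕn+[a/ℕn]*n (+ d ℤ.* q) d)) (cancel (+ r) (q' ℤ.* + d)))
    where
    distribute : ∀ d q q' → d ℤ.* (q ℤ.- q') ≡ d ℤ.* q ℤ.- q' ℤ.* d
    distribute = solve-∀
    cancel : ∀ u v → u ℤ.+ v ℤ.- v ≡ u
    cancel = solve-∀
  small : d * ∣ q ℤ.- q' ∣ < d * 1
  small = begin-strict
    d * ∣ q ℤ.- q' ∣         ≡⟨ ℤₚ.abs-* (+ d) (q ℤ.- q') ⟨
    ∣ + d ℤ.* (q ℤ.- q') ∣   ≡⟨ cong ∣_∣ remainder ⟩
    r                        <⟨ ℤ-DivMod.n%ℕd<d (+ d ℤ.* q) d ⟩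
    d                        ≡⟨ ℕₚ.*-identityʳ d ⟨
    d * 1                    ∎
    where open ℕₚ.≤-Reasoning

derivOverFact-taylor : ∀ j f x → derivOverFact j f x ≡ taylor x j f
derivOverFact-taylor j f x =
  trans (cong (λ u → ℤ._/ℕ_ u (j !) {{j ℕₚ.!≢0}}) value) (/ℕ-exact (j !) (taylor x j f) {{j ℕₚ.!≢0}})
  where
  value : eval (deriv^ j f) x ≡ + (j !) ℤ.* taylor x j f
  value = trans (sym (trans (ℤₚ.*-identityˡ _) (taylor-zero x (deriv^ j f))))
    (trans (taylor-deriv^ x f j 0) (cong (λ l → + (l !) ℤ.* taylor x l f) (ℕₚ.+-identityʳ j)))

-- Powers of the prime in the values, and the two bounds on the number of factors

coprime-to-prime : ∀ {p a} → Prime p → ¬ (p ∣ a) → Coprime a p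
coprime-to-prime {p} {a} p-prime p∤a {i} (i∣a , i∣p) =
  [ (λ i≡1 → i≡1) , (λ i≡p → ⊥-elim (p∤a (subst (_∣ a) i≡p i∣a))) ]′ (prime⇒irreducible p-prime i∣p)

-- Being coprime to `p`, the number `a` loses nothing when the factors `p` are removed one at a time
-- by Euclid's lemma.
∣-without-prime : ∀ {p} a d k → Prime p → ¬ (p ∣ a) → a ∣ d * p ^ k → a ∣ d
∣-without-prime     a d zero    p-prime p∤a a∣ = subst (a ∣_) (ℕₚ.*-identityʳ d) a∣
∣-without-prime {p} a d (suc k) p-prime p∤a a∣ = ∣-without-prime a d k p-prime p∤a
  (coprime-divisor (coprime-to-prime p-prime p∤a) (subst (a ∣_) swap a∣))
  where
  swap : d * (p * p ^ k) ≡ p * (d * p ^ k)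
  swap = trans (sym (ℕₚ.*-assoc d p (p ^ k))) (trans (cong (_* p ^ k) (ℕₚ.*-comm d p)) (ℕₚ.*-assoc p d (p ^ k)))

^-∣-eval-prod : ∀ p x gs → All (λ g → p ∣ ∣ eval g x ∣) gs → p ^ length gs ∣ ∣ eval (prod gs) x ∣
^-∣-eval-prod p x []       []           = subst (λ y → 1 ∣ ∣ y ∣) (sym (eval-constant (+ 1) x)) ∣-refl
^-∣-eval-prod p x (g ∷ gs) (p∣g ∷ p∣gs) = subst (p ^ suc (length gs) ∣_)
  (sym (trans (cong ∣_∣ (eval-⊛ g (prod gs) x)) (ℤₚ.abs-* (eval g x) (eval (prod gs) x))))
  (*-pres-∣ p∣g (^-∣-eval-prod p x gs p∣gs))

-- Cancel `p` on both sides; if the right side ran out of factors `p` first, then `p` would divide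
-- `d`.
prime-exponent-≤ : ∀ {p} d k s → Prime p → ¬ (p ∣ d) → p ^ s ∣ d * p ^ k → s ≤ k
prime-exponent-≤     d k       zero    p-prime p∤d _ = z≤n
prime-exponent-≤ {p} d zero    (suc s) p-prime p∤d p^s∣ =
  ⊥-elim (p∤d (∣-trans (m∣m*n (p ^ s)) (subst (p ^ suc s ∣_) (ℕₚ.*-identityʳ d) p^s∣)))
prime-exponent-≤ {p} d (suc k) (suc s) p-prime p∤d p^s∣ = s≤s (prime-exponent-≤ d k s p-prime p∤d
  (*-cancelʳ-∣ p {{prime⇒nonZero p-prime}} (subst₂ _∣_ (ℕₚ.*-comm p (p ^ s)) swap p^s∣)))
  where
  swap : d * (p * p ^ k) ≡ d * p ^ k * p
  swap = trans (cong (d *_) (ℕₚ.*-comm p (p ^ k))) (sym (ℕₚ.*-assoc d (p ^ k) p))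

theorem2 : (f : Poly) (n : ℕ) → length f ≡ suc n →
    coeff f 0 ≢ + 0 → coeff f n ≢ + 0 →
    (m d k j p : ℕ) → j ≤ n → Prime p → ¬ (p ∣ d) →
    HeightBound f n m d →
    ∣ eval f (+ m) ∣ ≡ d * p ^ k →
    Coprime (p ^ k) ∣ derivOverFact j f (+ m) ∣ →
    AtMostIrreducibleFactors (k ⊓ j) f
theorem2 f n len f₀≢0 fₙ≢0 m d k j p j≤n p-prime p∤d height value coprime =
  conclude (factorise f n m d deg-f f₀≢0 height d>0 f (<-wellFounded _) (divides-refl f))
  where
  deg-f : HasDegree f n
  deg-f = fₙ≢0 , λ i n<i → coeff-length f i (subst (_≤ i) (sym len) n<i)
  -- The prime `p` divides 0 but not `d`.
  d>0 : 0 < d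
  d>0 = ℕₚ.n≢0⇒n>0 λ d≡0 → p∤d (subst (p ∣_) (sym d≡0) (p ∣0))
  conclude : Factorisation f → AtMostIrreducibleFactors (k ⊓ j) f
  conclude (c , gs , irreducible , f≈) = c , gs , irreducible , ℕₚ.⊓-glb length≤k length≤j , f≈
    where
    prod∣f : Divides (prod gs) f
    prod∣f = divides-right f [ c ] (prod gs) f (divides-refl f) f≈
    p∣value : ∀ {g} → Divides g f × ¬ IsConstant g → p ∣ ∣ eval g (+ m) ∣
    p∣value {g} (g∣f , nonconst) with p ∣? ∣ eval g (+ m) ∣
    ... | yes p∣g = p∣g
    -- Otherwise `g(m)` would divide `d p^k` and be prime to `p`, hence divide `d`, although it
    -- exceeds `d` in absolute value.
    ... | no  p∤g = ⊥-elim (ℕₚ.<⇒≱ (nonconstant-factor-value f n m d deg-f f₀≢0 height g g∣f nonconst)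
      (∣⇒≤ {{>-nonZero d>0}} (∣-without-prime ∣ eval g (+ m) ∣ d k p-prime p∤g
        (subst (∣ eval g (+ m) ∣ ∣_) value (eval-divides f g g∣f (+ m))))))
    all-values : All (λ g → p ∣ ∣ eval g (+ m) ∣) gs
    all-values = All.zipWith (λ {g} (g∣f , _ , nonconst) → p∣value {g} (g∣f , nonconst))
      (divides-prod f gs prod∣f , irreducible)
    length≤k : length gs ≤ k
    length≤k = prime-exponent-≤ d k (length gs) p-prime p∤d
      (subst (p ^ length gs ∣_) value (∣-trans (^-∣-eval-prod p (+ m) gs all-values) (eval-divides f (prod gs) prod∣f (+ m))))
    -- If `j` were smaller than the number of factors, `p` would divide both coprime numbers and so
    -- equal 1. That `p` divides `p ^ k` needs `k > 0`, which follows from `length≤k`.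
    length≤j : length gs ≤ j
    length≤j = ℕₚ.≮⇒≥ λ j<s → ¬prime[1] (subst Prime (coprime (p∣p^ (ℕₚ.<-≤-trans (ℕₚ.≤-<-trans z≤n j<s) length≤k) , p∣deriv j<s)) p-prime)
      where
      p∣p^ : ∀ {k} → 0 < k → p ∣ p ^ k
      p∣p^ {suc k} _ = m∣m*n (p ^ k)
      p∣deriv : j < length gs → p ∣ ∣ derivOverFact j f (+ m) ∣
      p∣deriv j<s = ℤ∣.∣⇒∣ᵤ (subst (+ p ∣ᶻ_)
        (sym (trans (derivOverFact-taylor j f (+ m)) (taylor-cong (+ m) j f ([ c ] ⊛ prod gs) f≈)))
        (vanishes-⊛ (+ p) (+ m) (length gs) [ c ] (prod gs)
          (vanishes-prod (+ p) (+ m) gs (All.map ℤ∣.∣ᵤ⇒∣ all-values)) j j<s))
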